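{- Let $k \geq 2$ be an integer and let $D$ be a semicomplete digraph of order $n \geq (9k)^{5}$ with $\delta^{0}(D) \geq \lceil (n+k-1)/2 \rceil$. Then for any two disjoint vertex sets $S = \{s\}$ and $T = \{t_{1}, \dots, t_{k}\}$ of $V(D)$ (so $s, t_1, \dots, t_k$ are $k+1$ distinct vertices), $D$ has a one-to-many $k$-disjoint directed path cover joining $S$ and $T$; that is, there exist directed paths $P_{1}, \dots, P_{k}$ in $D$ such that each $P_{i}$ is a directed path from $s$ to $t_{i}$, $V(P_{i}) \cap V(P_{j}) = \{s\}$ for all $i \neq j$, and $\bigcup_{i=1}^{k} V(P_{i}) = V(D)$.
   Context: A digraph $D$ is semicomplete if for every pair $x, y$ of distinct vertices there is at least one arc between $x$ and $y$ (i.e. $xy \in A(D)$ or $yx \in A(D)$ or both). The minimum semi-degree is $\delta^{0}(D) := \min\{\delta^{+}(D), \delta^{ - }(D)\}$, where $\delta^{+}(D)$ and $\delta^{ - }(D)$ are the minimum out-degree and minimum in-degree of $D$. All paths are directed paths (no repeated vertices). -}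

module Defs where

open import Data.Nat using (ℕ; suc; _+_; _∸_; _/_; _≤_)
open import Data.Bool using (Bool; true; false)
open import Data.Fin using (Fin)
open import Data.Fin.Subset using (Subset; ∣_∣)
open import Data.Vec using (tabulate)
open import Data.List using (List; []; _∷_; last)
open import Data.List.Relation.Unary.Unique.Propositional using (Unique)
open import Data.Maybe using (Maybe; just)
open import Relation.Binary.PropositionalEquality using (_≡_; _≢_)
open import Relation.Nullary using (¬_; does)
open import Data.Fin using (_≟_)
open import Data.Product using (_×_; ∃)

record Digraph (n : ℕ) : Set where
  field
    arc      : Fin n → Fin n → Bool
    loopless : ∀ v → arc v v ≡ false
open Digraph public

Semicomplete : ∀ {n} → Digraph n → Set
Semicomplete {n} D = ∀ (x y : Fin n) → x ≢ y → (arc D x y ≡ true) ⊎′ (arc D y x ≡ true)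
  where open import Data.Sum renaming (_⊎_ to _⊎′_)

outNbrs : ∀ {n} → Digraph n → Fin n → Subset n
outNbrs D u = tabulate (λ v → arc D u v)

inNbrs : ∀ {n} → Digraph n → Fin n → Subset n
inNbrs D v = tabulate (λ u → arc D u v)

outdeg : ∀ {n} → Digraph n → Fin n → ℕ
outdeg D u = ∣ outNbrs D u ∣

indeg : ∀ {n} → Digraph n → Fin n → ℕ
indeg D v = ∣ inNbrs D v ∣

MinSemiDegreeAtLeast : ∀ {n} → Digraph n → ℕ → Set
MinSemiDegreeAtLeast {n} D m = ∀ (v : Fin n) → (m ≤ outdeg D v) × (m ≤ indeg D v)

⌈_/2⌉ : ℕ → ℕ
⌈ m /2⌉ = (m + 1) / 2

data Walk {n : ℕ} (D : Digraph n) : List (Fin n) → Set where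
  single : ∀ v → Walk D (v ∷ [])
  step   : ∀ {u v vs} → arc D u v ≡ true → Walk D (v ∷ vs) → Walk D (u ∷ v ∷ vs)

record IsPath {n : ℕ} (D : Digraph n) (s t : Fin n) (P : List (Fin n)) : Set where
  field
    walk   : Walk D P
    unique : Unique P
    starts : ∃ λ rest → P ≡ s ∷ rest
    ends   : last P ≡ just t

{-# OPTIONS --safe #-}
module Submission where

-- Restarting at s whenever a vertex of T has been reached turns the required path system into a
-- single walk through all vertices other than s that ends in T. Two internally disjoint paths with
-- common ends in a semicomplete digraph merge into one path, and a strong semicomplete digraph has a
-- Hamiltonian cycle (Camion).
--
-- If no set of at most 10k vertices separates D, join s, a suitable vertex a and all of T by detours
-- of at most two vertices. The remaining vertices form a strong digraph; its Hamiltonian cycle, cut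
-- open at an arc e r with s → r and with e → a or e → t₁, is a second path from s to a or t₁, which is
-- merged with the first one.
--
-- Otherwise there are sets A and B containing all but 10k vertices with no arc from A to B, so by the
-- degree condition A and B are almost complete and all arcs from B to A are present. Counting degrees
-- yields at least k + 1 vertices having many in-neighbours in A and many out-neighbours in B. These
-- provide the passages from A to B for a skeleton through T and all vertices belonging neither
-- to A nor to B, and the rest of each side is inserted along a Hamiltonian cycle.

-- Let δ be the degree bound, so 2δ ≥ n + k - 1. The out-neighbours of one vertex and the
-- in-neighbours of another number at least n - 10k in total even after 5k used vertices are dropped
-- from each set; hence the threshold 10k between the two cases. Without a small cut, the obstacle
-- is that the out-neighbours of s and the in-neighbours of t₁ are only guaranteed to exceed n by k
-- - 1 in total, which the removal of the detours can use up; the vertex a enlarges the second set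
-- enough to survive the removal. With a small cut, the scarce resource is the way from A to B. In
-- the worst case each of the k targets needs a passage of its own and reaching B from s needs
-- another: these are the k + 1 vertices, and they are what the summand k in the degree bound pays
-- for.

open import Data.Nat using (ℕ; suc; _+_; _*_; _≤_)
open import Data.Nat.Properties
open import Data.Nat.Tactic.RingSolver using (solve)
open import Data.List using ([]; _∷_)
open import Relation.Binary.PropositionalEquality using (_≡_; refl)

-- Linear arithmetic

-- l ≤ r together with a semiring identity x + r + d ≡ y + l yields x ≤ y; linear
-- arithmetic below is a sum of hypotheses followed by such an identity.
lin : ∀ {l r} x y d → l ≤ r → x + r + d ≡ y + l → x ≤ y
lin {l} {r} x y d l≤r e = +-cancelʳ-≤ r x y
  (≤-trans (m≤m+n (x + r) d) (≤-trans (≤-reflexive e) (+-monoʳ-≤ y l≤r)))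

infixl 5 _⊕_
_⊕_ : ∀ {a b c d} → a ≤ b → c ≤ d → a + c ≤ b + d
_⊕_ = +-mono-≤

infix 6 _⊛_
_⊛_ : ∀ c {a b} → a ≤ b → c * a ≤ c * b
c ⊛ a≤b = *-monoʳ-≤ c a≤b

abstract
  room : ∀ (k : ℕ) {n d x f} → n + k ≤ 1 + d + d → d ≤ x + f → f ≤ k * 5 → k * 1000 ≤ n → 2 ≤ k →
    1 ≤ x
  room k {n} {d} {x} {f} h0 h1 h2 h3 h4 =
    *-cancelˡ-≤ 2 (lin (2 * 1) (2 * x) (1 + 989 * k) (h0 ⊕ 2 ⊛ h1 ⊕ 2 ⊛ h2 ⊕ h3 ⊕ 2 ⊛ h4)
      (solve (n ∷ k ∷ d ∷ x ∷ f ∷ [])))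

  no-gap : ∀ (k : ℕ) {n d x y f} → n + k ≤ 1 + d + d → d ≤ x + f → d ≤ y + f → f ≤ k * 5 → 2 ≤ k →
    n ≤ x + y + k * 10
  no-gap k {n} {d} {x} {y} {f} h0 h1 h2 h3 h4 =
    lin n (x + y + k * 10) 1 (h0 ⊕ h1 ⊕ h2 ⊕ 2 ⊛ h3 ⊕ h4) (solve (n ∷ k ∷ d ∷ x ∷ y ∷ f ∷ []))

  gain : ∀ (k : ℕ) {n d f g l x} → n + k ≤ 1 + d + d → d ≤ f → d ≤ g → g + l ≤ x → k * 6 ≤ l →
    2 ≤ k → n + k * 6 ≤ f + x
  gain k {n} {d} {f} {g} {l} {x} h0 h1 h2 h3 h4 h5 =
    lin (n + k * 6) (f + x) 1 (h0 ⊕ h1 ⊕ h2 ⊕ h3 ⊕ h4 ⊕ h5) (solve (n ∷ k ∷ d ∷ f ∷ g ∷ l ∷ x ∷ []))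

  large-factor : ∀ (k : ℕ) {n d p} → n + k ≤ 1 + d + d → d ≤ p + (1 + k) → k * 1000 ≤ n → 2 ≤ k →
    1 + n ≤ 4 * p
  large-factor k {n} {d} {p} h0 h1 h2 h3 =
    lin (1 + n) (4 * p) (1 + 994 * k) (2 ⊛ h0 ⊕ 4 ⊛ h1 ⊕ h2 ⊕ 4 ⊛ h3) (solve (n ∷ k ∷ d ∷ p ∷ []))

  dominating : ∀ (k : ℕ) {n d x y l} → n ≤ y + l → l + k * 6 ≤ d → d ≤ x → n + k * 6 ≤ x + y
  dominating k {n} {d} {x} {y} {l} h0 h1 h2 =
    lin (n + k * 6) (x + y) 0 (h0 ⊕ h1 ⊕ h2) (solve (n ∷ k ∷ d ∷ x ∷ y ∷ l ∷ []))

  large-rest : ∀ (k : ℕ) {n d l} → n + k ≤ 1 + d + d → k * 1000 ≤ n → 1 + d ≤ l + k * 6 → k * 24 ≤ l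
  large-rest k {n} {d} {l} h0 h1 h2 =
    *-cancelˡ-≤ 2 (lin (2 * (k * 24)) (2 * l) (1 + 941 * k) (h0 ⊕ h1 ⊕ 2 ⊛ h2)
      (solve (n ∷ k ∷ d ∷ l ∷ [])))

  spare : ∀ (k : ℕ) {n m} → m ≤ 1 + k → k * 1000 ≤ n → 2 ≤ k → 1 + m ≤ n
  spare k {n} {m} h0 h1 h2 =
    lin (1 + m) n (998 * k) (h0 ⊕ h1 ⊕ h2) (solve (n ∷ k ∷ m ∷ []))

  fits : ∀ (k : ℕ) {c} → c ≤ k * 2 + 2 → 2 ≤ k → 2 + k + c ≤ k * 5
  fits k {c} h0 h1 =
    lin (2 + k + c) (k * 5) 0 (h0 ⊕ 2 ⊛ h1) (solve (k ∷ c ∷ []))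

  -- Dropping m vertices costs each of the two sets at most m, but shortens the cycle by m as well.
  -- One loss of m ≤ 5k remains, which the surplus 6k outweighs.
  exceeds : ∀ (k : ℕ) {n f h p pf ph m} → n + k * 6 ≤ f + h → f ≤ pf + m → h ≤ ph + m → p + m ≤ n →
    m ≤ k * 5 → 2 ≤ k → 1 + p ≤ pf + ph
  exceeds k {n} {f} {h} {p} {pf} {ph} {m} h0 h1 h2 h3 h4 h5 =
    lin (1 + p) (pf + ph) 1 (h0 ⊕ h1 ⊕ h2 ⊕ h3 ⊕ h4 ⊕ h5)
      (solve (n ∷ k ∷ f ∷ h ∷ p ∷ pf ∷ ph ∷ m ∷ []))

  clash : ∀ (k : ℕ) {m} → k * 6 + m ≤ m → 2 ≤ k → 1 ≤ 0
  clash k {m} h0 h1 =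
    lin 1 0 (1 + 5 * k) (h0 ⊕ h1) (solve (k ∷ m ∷ []))

  tail-fits : ∀ (k : ℕ) {a b l} → a ≤ 2 → b ≤ 2 → 1 + l ≤ k → b + a + 2 * l ≤ k * 2 + 2
  tail-fits k {a} {b} {l} h0 h1 h2 =
    lin (b + a + 2 * l) (k * 2 + 2) 0 (h0 ⊕ h1 ⊕ 2 ⊛ h2) (solve (a ∷ b ∷ l ∷ k ∷ []))

  all-fit : ∀ (k : ℕ) {a b l w} → a ≤ 2 → b ≤ 2 → 1 + l ≤ k → w ≤ 2 * l → w + (b + a) ≤ k * 2 + 2
  all-fit k {a} {b} {l} {w} h0 h1 h2 h3 =
    lin (w + (b + a)) (k * 2 + 2) 0 (h0 ⊕ h1 ⊕ 2 ⊛ h2 ⊕ h3) (solve (a ∷ b ∷ l ∷ w ∷ k ∷ []))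

  still-small : ∀ (k : ℕ) {n x y p m} → n ≤ p + m → p ≤ x + y → m ≤ k * 5 → 2 ≤ k →
    n ≤ x + y + k * 10
  still-small k {n} {x} {y} {p} {m} h0 h1 h2 _ =
    lin n (x + y + k * 10) (5 * k) (h0 ⊕ h1 ⊕ h2) (solve (n ∷ x ∷ y ∷ p ∷ m ∷ k ∷ []))

  remaining : ∀ (k : ℕ) {n p m} → n ≤ p + m → m ≤ k * 5 → k * 1000 ≤ n → 2 ≤ k → 1 ≤ p
  remaining k {n} {p} {m} h0 h1 h2 h3 =
    lin 1 p (1 + 994 * k) (h0 ⊕ h1 ⊕ h2 ⊕ h3) (solve (n ∷ p ∷ m ∷ k ∷ []))

  few-outside : ∀ (k : ℕ) {n A B C} → n ≤ A + B + k * 10 → A + B + C ≤ n → C ≤ k * 10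
  few-outside k {n} {A} {B} {C} h0 h1 =
    lin C (k * 10) 0 (h0 ⊕ h1) (solve (n ∷ k ∷ A ∷ B ∷ C ∷ []))

  misses-core : ∀ (k : ℕ) {n d A o m C} → n + k ≤ 1 + (d + d) → A + d ≤ n → d ≤ o + C → C ≤ k * 10 →
    o + m ≤ A → 2 ≤ k → m ≤ k * 10
  misses-core k {n} {d} {A} {o} {m} {C} h0 h1 h2 h3 h4 h5 =
    lin m (k * 10) 1 (h0 ⊕ h1 ⊕ h2 ⊕ h3 ⊕ h4 ⊕ h5) (solve (n ∷ k ∷ d ∷ A ∷ o ∷ m ∷ C ∷ []))

  misses-low : ∀ (k : ℕ) {n d A o m C b} → n + k ≤ 1 + (d + d) → A + d ≤ n → d ≤ o + (b + C) →
    b ≤ k * 70 → C ≤ k * 10 → o + m ≤ A → 2 ≤ k → m ≤ k * 80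
  misses-low k {n} {d} {A} {o} {m} {C} {b} h0 h1 h2 h3 h4 h5 h6 =
    lin m (k * 80) 1 (h0 ⊕ h1 ⊕ h2 ⊕ h3 ⊕ h4 ⊕ h5 ⊕ h6) (solve (n ∷ k ∷ d ∷ A ∷ o ∷ m ∷ C ∷ b ∷ []))

  side-large : ∀ (k : ℕ) {n d A} → n + k ≤ 1 + (d + d) → d ≤ A + k * 10 → k * 1000 ≤ n → 2 ≤ k →
    k * 200 ≤ A
  side-large k {n} {d} {A} h0 h1 h2 h3 =
    *-cancelˡ-≤ 2 (lin (2 * (k * 200)) (2 * A) (1 + 580 * k) (h0 ⊕ 2 ⊛ h1 ⊕ h2 ⊕ h3)
      (solve (n ∷ k ∷ d ∷ A ∷ [])))

  doubles : ∀ (k : ℕ) {y p} → 1 + k * 20 ≤ y → y ≤ p + k * 10 → y ≤ p + p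
  doubles k {y} {p} h0 h1 =
    lin y (p + p) 1 (h0 ⊕ 2 ⊛ h1) (solve (k ∷ y ∷ p ∷ []))

  leftover : ∀ (k : ℕ) {y p} → 1 + k * 20 ≤ y → y ≤ p + k * 10 → 2 ≤ k → 1 ≤ p
  leftover k {y} {p} h0 h1 _ =
    lin 1 p (10 * k) (h0 ⊕ h1) (solve (k ∷ y ∷ p ∷ []))

  too-many : ∀ (k : ℕ) {p} → k * 200 * p ≤ k * 140 * p → 1 ≤ k * p → 1 ≤ 0
  too-many k {p} h0 h1 =
    lin 1 0 (59 * k * p) (h0 ⊕ h1) (solve (k ∷ p ∷ []))

  add-special : ∀ (k : ℕ) {m y s} → m ≤ y + s → y ≤ k * 20 → s ≤ k * 2 → m ≤ k * 22
  add-special k {m} {y} {s} h0 h1 h2 =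
    lin m (k * 22) 0 (h0 ⊕ h1 ⊕ h2) (solve (k ∷ m ∷ y ∷ s ∷ []))

  add-outside : ∀ (k : ℕ) {m y s} → m ≤ y + s → y ≤ k * 20 → s ≤ k * 10 → m ≤ k * 30
  add-outside k {m} {y} {s} h0 h1 h2 =
    lin m (k * 30) 0 (h0 ⊕ h1 ⊕ h2) (solve (k ∷ m ∷ y ∷ s ∷ []))

  -- Origin of 4232: a core of at most 30k · 70k vertices would give δ ≤ 2100k² + 32k, so n + k ≤ 1
  -- + 4200k² + 64k, where 64k ≤ 32k².
  core-large : ∀ (k : ℕ) {n d A c} → c * 1 ≤ k * 30 * (k * 70) → A ≤ c + k * 22 → d ≤ A + k * 10 →
    n + k ≤ 1 + (d + d) → k * k * 4232 ≤ n → k * 64 ≤ k * k * 32 → 2 ≤ k → 1 ≤ 0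
  core-large k {n} {d} {A} {c} h0 h1 h2 h3 h4 h5 h6 =
    lin 1 0 0 (2 ⊛ h0 ⊕ 2 ⊛ h1 ⊕ 2 ⊛ h2 ⊕ h3 ⊕ h4 ⊕ h5 ⊕ h6) (solve (n ∷ k ∷ d ∷ A ∷ c ∷ []))

  pick-room : ∀ (k : ℕ) {f m q x y} → k * 46 + q + 1 ≤ x → m ≤ k * 22 → f ≤ k * 24 →
    y ≤ m + (q + f) → 1 + y ≤ x
  pick-room k {f} {m} {q} {x} {y} h0 h1 h2 h3 =
    lin (1 + y) x 0 (h0 ⊕ h1 ⊕ h2 ⊕ h3) (solve (k ∷ f ∷ m ∷ q ∷ x ∷ y ∷ []))

  room-low : ∀ (k : ℕ) {q A} → q ≤ k * 80 → k * 200 ≤ A → 2 ≤ k → k * 46 + q + 1 ≤ A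
  room-low k {q} {A} h0 h1 h2 =
    lin (k * 46 + q + 1) A (1 + 73 * k) (h0 ⊕ h1 ⊕ h2) (solve (k ∷ q ∷ A ∷ []))

  room-in : ∀ (k : ℕ) {q x} → q ≤ k * 20 → k * 70 ≤ x → 2 ≤ k → k * 46 + q + 1 ≤ x
  room-in k {q} {x} h0 h1 h2 =
    lin (k * 46 + q + 1) x (1 + 3 * k) (h0 ⊕ h1 ⊕ h2) (solve (k ∷ q ∷ x ∷ []))

  sum-twenty : ∀ (k : ℕ) {a b c} → c ≤ a + b → a ≤ k * 10 → b ≤ k * 10 → c ≤ k * 20
  sum-twenty k {a} {b} {c} h0 h1 h2 =
    lin c (k * 20) 0 (h0 ⊕ h1 ⊕ h2) (solve (k ∷ a ∷ b ∷ c ∷ []))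

  absorbs : ∀ (k : ℕ) {l lf ln lh x m f} → l ≤ lf + ln → ln ≤ k * 20 → x ≤ m + (lh + f) →
    k * 70 ≤ x → m ≤ k * 22 → f ≤ k * 24 → 2 ≤ k → 1 + l ≤ lf + lh
  absorbs k {l} {lf} {ln} {lh} {x} {m} {f} h0 h1 h2 h3 h4 h5 h6 =
    lin (1 + l) (lf + lh) (1 + 3 * k) (h0 ⊕ h1 ⊕ h2 ⊕ h3 ⊕ h4 ⊕ h5 ⊕ h6)
      (solve (k ∷ l ∷ lf ∷ ln ∷ lh ∷ x ∷ m ∷ f ∷ []))

  both-sides : ∀ (k : ℕ) {n d a b o z} → 1 + d ≤ a → 1 + d ≤ b → a + b ≤ o + z → o ≤ n →
    n + k ≤ 1 + (d + d) → 1 + k ≤ z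
  both-sides k {n} {d} {a} {b} {o} {z} h0 h1 h2 h3 h4 =
    lin (1 + k) z 0 (h0 ⊕ h1 ⊕ h2 ⊕ h3 ⊕ h4) (solve (n ∷ k ∷ d ∷ a ∷ b ∷ o ∷ z ∷ []))

  tail-room : ∀ (k : ℕ) {f l} → f ≤ 2 → 1 + l ≤ k * 11 → f + 2 * l ≤ k * 24
  tail-room k {f} {l} h0 h1 =
    lin (f + 2 * l) (k * 24) (2 * k) (h0 ⊕ 2 ⊛ h1) (solve (k ∷ f ∷ l ∷ []))

  grown : ∀ (k : ℕ) {w f l} → w ≤ 2 * l → f ≤ 2 → 1 + l ≤ k * 11 → 2 ≤ k → 2 + (w + f) ≤ k * 24
  grown k {w} {f} {l} h0 h1 h2 h3 =
    lin (2 + (w + f)) (k * 24) k (h0 ⊕ h1 ⊕ 2 ⊛ h2 ⊕ h3) (solve (k ∷ w ∷ f ∷ l ∷ []))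

  double : ∀ (k : ℕ) {c} → c ≤ 1 + k → 2 ≤ k → c ≤ k * 2
  double k {c} h0 h1 =
    lin c (k * 2) 1 (h0 ⊕ h1) (solve (k ∷ c ∷ []))

  surplus : ∀ (k : ℕ) {z a b} → 1 + k ≤ z + a → k ≤ a + b → a + b ≤ k → 1 + b ≤ z
  surplus k {z} {a} {b} h0 _ h2 =
    lin (1 + b) z 0 (h0 ⊕ h2) (solve (k ∷ z ∷ a ∷ b ∷ []))

  first-prefix : ∀ (k : ℕ) {z l} → 1 + l ≤ z + k → 1 + z ≤ k * 10 → 1 + l ≤ k * 11
  first-prefix k {z} {l} h0 h1 =
    lin (1 + l) (k * 11) 1 (h0 ⊕ h1) (solve (k ∷ z ∷ l ∷ []))

  first-tail : ∀ (k : ℕ) {z l} → 1 + l ≤ z + k → z ≤ k * 10 → 1 + l ≤ k * 11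
  first-tail k {z} {l} h0 h1 =
    lin (1 + l) (k * 11) 0 (h0 ⊕ h1) (solve (k ∷ z ∷ l ∷ []))

open import Defs
open import Data.Nat using (_∸_; _^_; _<_; zero; z≤n; s≤s; _≤?_; _/_; _%_; NonZero; >-nonZero)
open import Data.Nat.DivMod using (m≡m%n+[m/n]*n; m%n<n)
open import Data.Nat.Tactic.RingSolver using (solve-∀)
open import Data.Bool using (Bool; true; false; if_then_else_; _∧_; _∨_; not)
open import Data.Bool.Properties using () renaming (_≟_ to _≟ᵇ_)
open import Data.Fin using (Fin; zero; suc) renaming (_≟_ to _≟ᶠ_)
open import Data.Fin.Properties using (any?; all?)
import Data.Fin.Subset as Subset
open import Data.Fin.Subset.Properties using (anySubset?)
import Data.Vec as Vec
open import Data.Vec.Properties using (lookup∘tabulate)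
open import Data.Maybe using (just)
open import Data.List using (List; _++_; length; filter; tabulate; allFin; map; concat; reverse; last)
open import Data.List.Properties
  using (++-assoc; length-++; ++-identityʳ; length-tabulate; unfold-reverse; ∷ʳ-injective)
open import Data.List.Membership.Propositional using (_∈_; _∉_)
open import Data.List.Membership.Propositional.Properties
open import Data.List.Membership.Propositional.Properties.WithK using (unique∧set⇒bag)
open import Data.List.Membership.DecPropositional using (_∈?_)
open import Data.List.Relation.Unary.Any using (here; there)
open import Data.List.Relation.Unary.All using (All; []; _∷_)
import Data.List.Relation.Unary.All as All
import Data.List.Relation.Unary.All.Properties as All
open import Data.List.Relation.Unary.AllPairs using ([]; _∷_)
open import Data.List.Relation.Unary.Unique.Propositional using (Unique)
import Data.List.Relation.Unary.Unique.Propositional.Properties as Unique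
open import Data.List.Relation.Binary.BagAndSetEquality using (∼bag⇒↭)
open import Data.List.Relation.Binary.Permutation.Propositional
  using (_↭_; ↭-refl; ↭-sym; ↭-trans; prep; swap; ↭-reflexive; ↭⇒↭ₛ)
open import Data.List.Relation.Binary.Permutation.Propositional.Properties
  using (∈-resp-↭; ↭-length; shift; ++⁺; ++⁺ˡ; ++⁺ʳ; ++-comm; ↭-reverse; ++-commutativeMonoid)
open import Data.List.Relation.Binary.Permutation.Setoid.Properties using (Unique-resp-↭)
import Algebra.Solver.CommutativeMonoid
open import Data.Product using (Σ; ∃; ∃₂; _×_; _,_; proj₁; proj₂)
open import Data.Sum using (_⊎_; inj₁; inj₂; [_,_]′)
import Data.Sum
open import Data.Unit using (⊤; tt)
open import Data.Empty using (⊥; ⊥-elim)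
open import Relation.Nullary using (¬_; Dec; yes; no; does)
open import Relation.Nullary.Decidable using (_×-dec_; dec-true; dec-false)
open import Relation.Binary.PropositionalEquality
  using (_≢_; sym; trans; cong; cong₂; subst; subst₂; setoid)
open import Function using (_∘_; id; flip; case_of_)
open import Function.Bundles using (mk⇔)
open import Function.Definitions using (Injective)

-- Booleans, sums and counting over lists

true≢false : ∀ {ℓ} {X : Set ℓ} {b : Bool} → b ≡ true → b ≡ false → X
true≢false refl ()

¬true⇒false : ∀ {b} → ¬ b ≡ true → b ≡ false
¬true⇒false {true} h = ⊥-elim (h refl)
¬true⇒false {false} h = refl

∧-split : ∀ {a b} → a ∧ b ≡ true → a ≡ true × b ≡ true
∧-split {true} {true} _ = refl , refl

∧-join : ∀ {a b} → a ≡ true → b ≡ true → a ∧ b ≡ true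
∧-join refl refl = refl

not-true : ∀ {b} → not b ≡ true → b ≡ false
not-true {false} _ = refl

not-false : ∀ {b} → b ≡ false → not b ≡ true
not-false refl = refl

∨-split : ∀ {a b} → a ∨ b ≡ true → a ≡ true ⊎ b ≡ true
∨-split {true} _ = inj₁ refl
∨-split {false} p = inj₂ p

∨-inr : ∀ {a b} → b ≡ true → a ∨ b ≡ true
∨-inr {true} _ = refl
∨-inr {false} p = p

∨-inl : ∀ {a b} → a ≡ true → a ∨ b ≡ true
∨-inl refl = refl

bool : (b : Bool) → b ≡ true ⊎ b ≡ false
bool true = inj₁ refl
bool false = inj₂ refl

𝟙 : Bool → ℕ
𝟙 true = 1
𝟙 false = 0

𝟙-mono : ∀ {a b} → (a ≡ true → b ≡ true) → 𝟙 a ≤ 𝟙 b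
𝟙-mono {false} h = z≤n
𝟙-mono {true} h rewrite h refl = ≤-refl

module _ {A : Set} where

  Σ[_] : (A → ℕ) → List A → ℕ
  Σ[ f ] [] = 0
  Σ[ f ] (x ∷ xs) = f x + Σ[ f ] xs

  Σ-mono : ∀ {f g : A → ℕ} xs → (∀ x → f x ≤ g x) → Σ[ f ] xs ≤ Σ[ g ] xs
  Σ-mono [] h = z≤n
  Σ-mono (x ∷ xs) h = h x ⊕ Σ-mono xs h

  Σ-+ : ∀ (f g : A → ℕ) xs → Σ[ (λ x → f x + g x) ] xs ≡ Σ[ f ] xs + Σ[ g ] xs
  Σ-+ f g [] = refl
  Σ-+ f g (x ∷ xs) rewrite Σ-+ f g xs = interchange (f x) (g x) (Σ[ f ] xs) (Σ[ g ] xs)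
    where
    interchange : ∀ a b c d → a + b + (c + d) ≡ a + c + (b + d)
    interchange = solve-∀

  Σ-↭ : ∀ {f : A → ℕ} {xs ys} → xs ↭ ys → Σ[ f ] xs ≡ Σ[ f ] ys
  Σ-↭ _↭_.refl = refl
  Σ-↭ {f} (prep x p) = cong (f x +_) (Σ-↭ p)
  Σ-↭ {f} (swap {xs} {ys} x y p) rewrite Σ-↭ {f} p = exchange (f x) (f y) (Σ[ f ] ys)
    where
    exchange : ∀ a b c → a + (b + c) ≡ b + (a + c)
    exchange = solve-∀
  Σ-↭ (_↭_.trans p q) = trans (Σ-↭ p) (Σ-↭ q)

  count : (A → Bool) → List A → ℕ
  count p = Σ[ (λ x → 𝟙 (p x)) ]

  count-all : ∀ {p : A → Bool} xs → (∀ {x} → x ∈ xs → p x ≡ true) → count p xs ≡ length xs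
  count-all [] h = refl
  count-all (x ∷ xs) h rewrite h (here refl) = cong suc (count-all xs (h ∘ there))

  count-none : ∀ {p : A → Bool} xs → (∀ {x} → x ∈ xs → p x ≡ false) → count p xs ≡ 0
  count-none [] h = refl
  count-none (x ∷ xs) h rewrite h (here refl) = count-none xs (h ∘ there)

  ∃-count : ∀ {p : A → Bool} xs → 0 < count p xs → ∃ λ x → x ∈ xs × p x ≡ true
  ∃-count {p} (x ∷ xs) h with p x in eq
  ... | true = x , here refl , eq
  ... | false with ∃-count xs h
  ...   | y , y∈ , py = y , there y∈ , py

  count>0 : ∀ {p : A → Bool} {x} xs → x ∈ xs → p x ≡ true → 0 < count p xs
  count>0 {p} (x ∷ xs) (here refl) px rewrite px = s≤s z≤n
  count>0 {p} (x ∷ xs) (there x∈) px = ≤-trans (count>0 xs x∈ px) (m≤n+m _ (𝟙 (p x)))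

  select : (A → Bool) → List A → List A
  select p = filter (λ x → p x ≟ᵇ true)

  length-select : ∀ (p : A → Bool) xs → length (select p xs) ≡ count p xs
  length-select p [] = refl
  length-select p (x ∷ xs) with p x
  ... | true = cong suc (length-select p xs)
  ... | false = length-select p xs

  count-select : ∀ (p q : A → Bool) xs → count p (select q xs) ≡ count (λ x → q x ∧ p x) xs
  count-select p q [] = refl
  count-select p q (x ∷ xs) with q x
  ... | true = cong (𝟙 (p x) +_) (count-select p q xs)
  ... | false = count-select p q xs

Σ-comm : ∀ {A B : Set} (f : A → B → ℕ) xs ys →
         Σ[ (λ x → Σ[ f x ] ys) ] xs ≡ Σ[ (λ y → Σ[ (λ x → f x y) ] xs) ] ys
Σ-comm f [] [] = refl
Σ-comm f [] (y ∷ ys) = Σ-comm f [] ys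
Σ-comm f (x ∷ xs) ys rewrite Σ-comm f xs ys =
  sym (Σ-+ (f x) (λ y → Σ[ (λ x′ → f x′ y) ] xs) ys)

Σ-*ʳ : ∀ {A : Set} (f : A → ℕ) c xs → Σ[ (λ x → f x * c) ] xs ≡ Σ[ f ] xs * c
Σ-*ʳ f c [] = refl
Σ-*ʳ f c (x ∷ xs) rewrite Σ-*ʳ f c xs = sym (*-distribʳ-+ c (f x) (Σ[ f ] xs))

-- Sets of vertices and their sizes

module Counting {n : ℕ} where

  V : Set
  V = Fin n

  infix 30 #_
  #_ : (V → Bool) → ℕ
  # p = count p (allFin n)

  ∈V : (v : V) → v ∈ allFin n
  ∈V = ∈-allFin

  #-mono : ∀ {p q} → (∀ v → p v ≡ true → q v ≡ true) → # p ≤ # q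
  #-mono h = Σ-mono (allFin n) (λ v → 𝟙-mono (h v))

  #-∨ : ∀ p q → # (λ v → p v ∨ q v) ≤ # p + # q
  #-∨ p q = ≤-trans (Σ-mono (allFin n) (λ v → pt (p v) (q v))) (≤-reflexive (Σ-+ _ _ (allFin n)))
    where
    pt : ∀ a b → 𝟙 (a ∨ b) ≤ 𝟙 a + 𝟙 b
    pt true b = s≤s z≤n
    pt false b = ≤-refl

  #-∪∩ : ∀ p q → # p + # q ≡ # (λ v → p v ∨ q v) + # (λ v → p v ∧ q v)
  #-∪∩ p q = ≤-antisym
    (≤-trans (≤-reflexive (sym (Σ-+ _ _ (allFin n))))
      (≤-trans (Σ-mono (allFin n) (λ v → ≤-reflexive (pt (p v) (q v)))) (≤-reflexive (Σ-+ _ _ (allFin n)))))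
    (≤-trans (≤-reflexive (sym (Σ-+ _ _ (allFin n))))
      (≤-trans (Σ-mono (allFin n) (λ v → ≤-reflexive (sym (pt (p v) (q v))))) (≤-reflexive (Σ-+ _ _ (allFin n)))))
    where
    pt : ∀ a b → 𝟙 a + 𝟙 b ≡ 𝟙 (a ∨ b) + 𝟙 (a ∧ b)
    pt true true = refl
    pt true false = refl
    pt false true = refl
    pt false false = refl

  #-cover : ∀ {p q r} → (∀ v → p v ≡ true → q v ≡ true ⊎ r v ≡ true) → # p ≤ # q + # r
  #-cover {p} {q} {r} h = ≤-trans (#-mono (λ v pv → [ ∨-inl , ∨-inr ]′ (h v pv))) (#-∨ q r)

  #-disjoint : ∀ {p q r} → (∀ v → p v ≡ true → r v ≡ true) → (∀ v → q v ≡ true → r v ≡ true) →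
               (∀ v → p v ≡ true → q v ≡ true → ⊥) → # p + # q ≤ # r
  #-disjoint {p} {q} {r} pr qr d = ≤-trans (≤-reflexive (sym (Σ-+ _ _ (allFin n))))
    (Σ-mono (allFin n) pt)
    where
    pt : ∀ v → 𝟙 (p v) + 𝟙 (q v) ≤ 𝟙 (r v)
    pt v with p v in ep | q v in eq
    ... | true | true = ⊥-elim (d v ep eq)
    ... | true | false rewrite pr v ep = ≤-refl
    ... | false | true rewrite qr v eq = ≤-refl
    ... | false | false = z≤n

  #-total : # (λ _ → true) ≡ n
  #-total = trans (count-all (allFin n) (λ _ → refl)) (length-tab n id)
    where
    length-tab : ∀ {A : Set} m (f : Fin m → A) → length (tabulate f) ≡ m
    length-tab zero f = refl
    length-tab (suc m) f = cong suc (length-tab m (f ∘ suc))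

  #≤n : ∀ p → # p ≤ n
  #≤n p = ≤-trans (#-mono {p} {λ _ → true} (λ _ _ → refl)) (≤-reflexive #-total)

  pick : ∀ {p q} → # q < # p → ∃ λ v → p v ≡ true × q v ≡ false
  pick {p} {q} h with any? (λ v → (p v ≟ᵇ true) ×-dec (q v ≟ᵇ false))
  ... | yes r = r
  ... | no ¬r = ⊥-elim (<⇒≱ h (#-mono (λ v pv → case bool (q v) of λ
                  { (inj₁ t) → t ; (inj₂ f) → ⊥-elim (¬r (v , pv , f)) })))

  mem : List V → V → Bool
  mem xs v = does (_∈?_ _≟ᶠ_ v xs)

  mem⁺ : ∀ {xs v} → v ∈ xs → mem xs v ≡ true
  mem⁺ {xs} {v} v∈ = dec-true (_∈?_ _≟ᶠ_ v xs) v∈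

  mem⁻ : ∀ {xs v} → mem xs v ≡ true → v ∈ xs
  mem⁻ {xs} {v} e with _∈?_ _≟ᶠ_ v xs
  ... | yes p = p

  ∉⇒mem : ∀ {xs v} → v ∉ xs → mem xs v ≡ false
  ∉⇒mem {xs} {v} v∉ = dec-false (_∈?_ _≟ᶠ_ v xs) v∉

  mem⇒∉ : ∀ {xs v} → mem xs v ≡ false → v ∉ xs
  mem⇒∉ e v∈ = true≢false (mem⁺ v∈) e

  #-⊆list : ∀ {p} xs → (∀ v → p v ≡ true → v ∈ xs) → # p ≤ length xs
  #-⊆list {p} xs h = ≤-trans (#-mono (λ v pv → mem⁺ (h v pv))) (members xs)
    where
    one : ∀ x ys → Unique ys → count (λ v → does (v ≟ᶠ x)) ys ≤ 1
    one x [] _ = z≤n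
    one x (y ∷ ys) (y≢ ∷ u) with y ≟ᶠ x
    ... | no _ = one x ys u
    ... | yes refl = s≤s (≤-reflexive (count-none ys
                       (λ {v} v∈ → dec-false (v ≟ᶠ y) (λ e → All.lookup y≢ v∈ (sym e)))))
    members : ∀ xs → # (mem xs) ≤ length xs
    members [] = ≤-reflexive (count-none (allFin n) (λ _ → refl))
    members (x ∷ xs) = ≤-trans (#-cover {mem (x ∷ xs)} {λ v → does (v ≟ᶠ x)} {mem xs} cov)
                             (one x (allFin n) (Unique.allFin⁺ n) ⊕ members xs)
      where
      cov : ∀ v → mem (x ∷ xs) v ≡ true → does (v ≟ᶠ x) ≡ true ⊎ mem xs v ≡ true
      cov v e with mem⁻ {x ∷ xs} e
      ... | here v≡x = inj₁ (dec-true (v ≟ᶠ x) v≡x)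
      ... | there v∈ = inj₂ (mem⁺ v∈)

  #-mem : ∀ xs → # (mem xs) ≤ length xs
  #-mem xs = #-⊆list xs (λ v → mem⁻)

  #-singleton : ∀ (x : V) {p} → p x ≡ true → 1 ≤ # p
  #-singleton x = count>0 (allFin n) (∈V x)

  double-count : (_⇒_ : V → V → Bool) (X Y : V → Bool) (p q : ℕ) →
    (∀ x → X x ≡ true → p ≤ # (λ y → Y y ∧ (x ⇒ y))) →
    (∀ y → Y y ≡ true → # (λ x → X x ∧ (x ⇒ y)) ≤ q) → # X * p ≤ # Y * q
  double-count _⇒_ X Y p q hX hY = ≤-trans (≤-reflexive (sym (Σ-*ʳ (𝟙 ∘ X) p (allFin n))))
    (≤-trans (Σ-mono (allFin n) left)
    (≤-trans (≤-reflexive (Σ-comm (λ x y → 𝟙 (X x ∧ (Y y ∧ (x ⇒ y)))) (allFin n) (allFin n)))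
    (≤-trans (Σ-mono (allFin n) right) (≤-reflexive (Σ-*ʳ (𝟙 ∘ Y) q (allFin n))))))
    where
    left : ∀ x → 𝟙 (X x) * p ≤ # (λ y → X x ∧ (Y y ∧ (x ⇒ y)))
    left x with X x in e
    ... | false = z≤n
    ... | true = ≤-trans (≤-reflexive (*-identityˡ p)) (hX x e)
    right : ∀ y → # (λ x → X x ∧ (Y y ∧ (x ⇒ y))) ≤ 𝟙 (Y y) * q
    right y with Y y in e
    ... | false = ≤-reflexive (count-none (allFin n) (λ {x} _ → case bool (X x) of λ
                    { (inj₁ t) → subst (λ b → b ∧ false ≡ false) (sym t) refl
                    ; (inj₂ f) → subst (λ b → b ∧ false ≡ false) (sym f) refl }))
    ... | true = ≤-trans (hY y e) (≤-reflexive (sym (*-identityˡ q)))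

  sel : (V → Bool) → List V
  sel p = select p (allFin n)

  ∈-sel⁺ : ∀ {p v} → p v ≡ true → v ∈ sel p
  ∈-sel⁺ {p} {v} pv = ∈-filter⁺ (λ x → p x ≟ᵇ true) (∈V v) pv

  ∈-sel⁻ : ∀ {p v} → v ∈ sel p → p v ≡ true
  ∈-sel⁻ {p} v∈ = proj₂ (∈-filter⁻ (λ x → p x ≟ᵇ true) {xs = allFin n} v∈)

  sel-unique : ∀ p → Unique (sel p)
  sel-unique p = Unique.filter⁺ (λ x → p x ≟ᵇ true) (Unique.allFin⁺ n)

  length-sel : ∀ p → length (sel p) ≡ # p
  length-sel p = length-select p (allFin n)

unique-↭ : ∀ {A : Set} {as bs : List A} → as ↭ bs → Unique as → Unique bs
unique-↭ {A} p = Unique-resp-↭ (setoid A) (↭⇒↭ₛ p)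

unique-disjoint : ∀ {A : Set} (as : List A) {bs v} → Unique (as ++ bs) → v ∈ as → v ∈ bs → ⊥
unique-disjoint (a ∷ as) (a≢ ∷ u) (here refl) v∈bs = All.lookup a≢ (∈-++⁺ʳ as v∈bs) refl
unique-disjoint (a ∷ as) (a≢ ∷ u) (there v∈as) v∈bs = unique-disjoint as u v∈as v∈bs

does-true : ∀ {P : Set} (d : Dec P) → does d ≡ true → P
does-true (yes p) _ = p

infixr 5 _∷_
data Chain {A : Set} (R : A → A → Set) : A → List A → A → Set where
  stop : ∀ {u} → Chain R u [] u
  _∷_  : ∀ {u x W ℓ} → R u x → Chain R x W ℓ → Chain R u (x ∷ W) ℓ

-- Walks in semicomplete digraphs

module Walks {n : ℕ} (_⇒_ : Fin n → Fin n → Bool) where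
  open Counting {n}

  infix 4 _⟶_
  _⟶_ : V → V → Set
  u ⟶ v = (u ⇒ v) ≡ true

  -- `Path` lists interior vertices only, so that two paths with common ends merge as lists; `Run`
  -- lists all vertices but the first, which suits concatenation.
  Path : V → List V → V → Set
  Path u [] v = u ⟶ v
  Path u (x ∷ W) v = u ⟶ x × Path x W v

  Run : V → List V → V → Set
  Run = Chain _⟶_

  path-run : ∀ {u} W {v S ℓ} → Path u W v → Run v S ℓ → Run u (W ++ v ∷ S) ℓ
  path-run [] e r = e ∷ r
  path-run (x ∷ W) (e , p) r = e ∷ path-run W p r

  run-path : ∀ {c cs ℓ v} → Run c cs ℓ → ℓ ⟶ v → Path c cs v
  run-path stop e = e
  run-path (d ∷ r) e = d , run-path r e

  path-++ : ∀ {u} X {a Y v} → Path u X a → Path a Y v → Path u (X ++ a ∷ Y) v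
  path-++ [] e q = e , q
  path-++ (x ∷ X) (e , p) q = e , path-++ X p q

  run-++ : ∀ {a X b Y d} → Run a X b → Run b Y d → Run a (X ++ Y) d
  run-++ stop s = s
  run-++ (e ∷ r) s = e ∷ run-++ r s

  run-last : ∀ {c cs ℓ} → Run c cs ℓ → ℓ ∈ c ∷ cs
  run-last stop = here refl
  run-last (_ ∷ r) = there (run-last r)

  Semi : V → List V → Set
  Semi x ys = ∀ {y} → y ∈ ys → x ⟶ y ⊎ y ⟶ x

  -- Of the two first interior vertices, the one with an arc to the other is taken. That arc makes
  -- the remaining paths start at a common vertex again.
  merge : ∀ {u v} X W → (∀ {x} → x ∈ X → Semi x W) → Path u X v → Path u W v →
          ∃ λ M → M ↭ X ++ W × Path u M v
  merge [] W semi p q = W , ↭-refl , q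
  merge (x ∷ X) [] semi p q = x ∷ X , ↭-reflexive (sym (++-identityʳ (x ∷ X))) , p
  merge (x ∷ X) (w ∷ W) semi (e , p) (d , q) =
    [ (λ x⟶w → case merge X (w ∷ W) (semi ∘ there) p (x⟶w , q) of λ
        { (M , perm , r) → x ∷ M , prep x perm , e , r })
    , (λ w⟶x → case merge (x ∷ X) W (λ x∈ w∈ → semi x∈ (there w∈)) (w⟶x , p) q of λ
        { (M , perm , r) → w ∷ M , ↭-trans (prep w perm) (↭-sym (shift w (x ∷ X) W)) , d , r })
    ]′ (semi (here refl) (here refl))

  swap-front : ∀ {d x : V} {ds zs} → zs ↭ x ∷ ds → d ∷ zs ↭ x ∷ d ∷ ds
  swap-front {d} {x} p = ↭-trans (prep d p) (swap d x ↭-refl)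

  insert-run : ∀ {y ys ℓ x} → Run y ys ℓ → y ⟶ x → Semi x ys →
               ∃₂ λ zs ℓ′ → zs ↭ x ∷ ys × Run y zs ℓ′
  insert-run {x = x} stop e semi = x ∷ [] , x , ↭-refl , e ∷ stop
  insert-run {ys = d ∷ ds} {x = x} (f ∷ r) e semi with semi (here refl)
  ... | inj₁ x⟶d = x ∷ d ∷ ds , _ , ↭-refl , e ∷ x⟶d ∷ r
  ... | inj₂ d⟶x with insert-run r d⟶x (semi ∘ there)
  ...   | zs , ℓ′ , perm , r′ = d ∷ zs , ℓ′ , swap-front perm , f ∷ r′

  -- Rédei's theorem by insertion: x goes in front of a Hamiltonian path of the others, or else the
  -- first vertex has an arc to x and x is inserted further on.
  ham-path : ∀ x xs → Unique (x ∷ xs) → (∀ {y z} → y ∈ x ∷ xs → z ∈ x ∷ xs → y ≢ z → y ⟶ z ⊎ z ⟶ y) →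
             ∃ λ r → ∃₂ λ rs ℓ → r ∷ rs ↭ x ∷ xs × Run r rs ℓ
  ham-path x [] u semi = x , [] , x , ↭-refl , stop
  ham-path x (y ∷ ys) (x≢ ∷ u) semi with ham-path y ys u (λ p q → semi (there p) (there q))
  ... | r , rs , ℓ , perm , run with semi-x (here refl)
    where
    semi-x : Semi x (r ∷ rs)
    semi-x z∈ = semi (here refl) (there (∈-resp-↭ perm z∈)) (All.lookup x≢ (∈-resp-↭ perm z∈))
  ...   | inj₁ x⟶r = x , r ∷ rs , ℓ , prep x perm , x⟶r ∷ run
  ...   | inj₂ r⟶x with insert-run run r⟶x (λ z∈ → semi (here refl) (there (∈-resp-↭ perm (there z∈)))
                                                       (All.lookup x≢ (∈-resp-↭ perm (there z∈))))
  ...     | zs , ℓ′ , perm′ , run′ = r , zs , ℓ′ , ↭-trans (swap-front perm′) (prep x perm) , run′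

  -- The arc from the current vertex to x persists until x has an arc to the next vertex; q
  -- guarantees that this happens.
  insert-before : ∀ {c cs ℓ x q} → Run c cs ℓ → c ⟶ x → q ∈ cs → x ⟶ q → Semi x cs →
                  ∃ λ cs′ → cs′ ↭ x ∷ cs × Run c cs′ ℓ
  insert-before {cs = d ∷ ds} {x = x} (e ∷ r) c⟶x q∈ x⟶q semi with semi (here refl)
  ... | inj₁ x⟶d = x ∷ d ∷ ds , ↭-refl , c⟶x ∷ x⟶d ∷ r
  insert-before {cs = d ∷ ds} {x = x} (e ∷ r) c⟶x (here refl) x⟶q semi | inj₂ d⟶x =
    x ∷ d ∷ ds , ↭-refl , c⟶x ∷ x⟶q ∷ r
  insert-before {cs = d ∷ ds} {x = x} (e ∷ r) c⟶x (there q∈) x⟶q semi | inj₂ d⟶x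
    with insert-before r d⟶x q∈ x⟶q (semi ∘ there)
  ... | cs′ , perm , r′ = d ∷ cs′ , swap-front perm , e ∷ r′

  -- Vertices without an arc to x are skipped; from the first one with such an arc on, ℓ serves as
  -- the later out-neighbour of x. Since ℓ has no arc to x, that vertex is not the last.
  insert-after : ∀ {c cs ℓ x p} → Run c cs ℓ → p ∈ c ∷ cs → p ⟶ x → x ⟶ ℓ → (ℓ ⇒ x) ≡ false → Semi x cs →
                 ∃ λ cs′ → cs′ ↭ x ∷ cs × Run c cs′ ℓ
  insert-after {c} {x = x} r p∈ p⟶x x⟶ℓ ℓ↛x semi with bool (c ⇒ x)
  insert-after stop p∈ p⟶x x⟶ℓ ℓ↛x semi | inj₁ c⟶x = true≢false c⟶x ℓ↛x
  insert-after (e ∷ r) p∈ p⟶x x⟶ℓ ℓ↛x semi | inj₁ c⟶x =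
    insert-before (e ∷ r) c⟶x (run-last r) x⟶ℓ semi
  insert-after r (here refl) p⟶x x⟶ℓ ℓ↛x semi | inj₂ c↛x = true≢false p⟶x c↛x
  insert-after {cs = d ∷ ds} (e ∷ r) (there p∈) p⟶x x⟶ℓ ℓ↛x semi | inj₂ c↛x
    with insert-after r p∈ p⟶x x⟶ℓ ℓ↛x (semi ∘ there)
  ... | cs′ , perm , r′ = d ∷ cs′ , swap-front perm , e ∷ r′

  -- A single vertex counts as a cycle.
  Closed : V → V → Set
  Closed c ℓ = ℓ ≡ c ⊎ ℓ ⟶ c

  Cycle : List V → Set
  Cycle xs = ∃ λ c → ∃₂ λ cs ℓ → Run c cs ℓ × Closed c ℓ × c ∷ cs ↭ xs

  -- The place where the cycle is cut open needs care: if `x ⟶ c`, then x goes into the closing arc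
  -- unless ℓ has no arc to x, in which case `x ⟶ ℓ` and x fits inside the run.
  insert-cycle : ∀ {c cs ℓ x p q} → Run c cs ℓ → Closed c ℓ → p ∈ c ∷ cs → p ⟶ x → q ∈ c ∷ cs → x ⟶ q →
                 Semi x (c ∷ cs) → Cycle (x ∷ c ∷ cs)
  insert-cycle {c} {cs} {ℓ} {x} r cl p∈ p⟶x q∈ x⟶q semi with bool (x ⇒ c)
  insert-cycle {c} {cs} {ℓ} {x} r cl p∈ p⟶x q∈ x⟶q semi | inj₁ x⟶c with bool (ℓ ⇒ x)
  ... | inj₁ ℓ⟶x = c , cs ++ x ∷ [] , x , run-++ r (ℓ⟶x ∷ stop) , inj₂ x⟶c , ++-comm (c ∷ cs) (x ∷ [])
  ... | inj₂ ℓ↛x with insert-after r p∈ p⟶x x⟶ℓ ℓ↛x (semi ∘ there)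
    where
    x⟶ℓ : x ⟶ ℓ
    x⟶ℓ = [ id , (λ e → true≢false e ℓ↛x) ]′ (semi (run-last r))
  ...   | cs′ , perm , r′ = c , cs′ , ℓ , r′ , cl , swap-front perm
  insert-cycle {c} {cs} {ℓ} {x} r cl p∈ p⟶x (here refl) x⟶q semi | inj₂ x↛c = true≢false x⟶q x↛c
  insert-cycle {c} {cs} {ℓ} {x} r cl p∈ p⟶x (there q∈) x⟶q semi | inj₂ x↛c
    with insert-before r ([ (λ e → true≢false e x↛c) , id ]′ (semi (here refl))) q∈ x⟶q (semi ∘ there)
  ... | cs′ , perm , r′ = c , cs′ , ℓ , r′ , cl , swap-front perm

  extract : ∀ {x : V} {xs} → x ∈ xs → ∃ λ ys → xs ↭ x ∷ ys
  extract {x} x∈ with ∈-∃++ x∈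
  ... | as , bs , refl = as ++ bs , shift x as bs

  Semicomplete-on : List V → Set
  Semicomplete-on xs = ∀ {x y} → x ∈ xs → y ∈ xs → x ≢ y → x ⟶ y ⊎ y ⟶ x

  Strong-on : List V → Set
  Strong-on xs = ∀ (X : V → Bool) {a b} → a ∈ xs → X a ≡ true → b ∈ xs → X b ≡ false →
    ∃₂ λ x y → x ∈ xs × X x ≡ true × y ∈ xs × X y ≡ false × x ⟶ y

  module Camion (xs : List V) (uniq : Unique xs) (semi : Semicomplete-on xs) (strong : Strong-on xs) where

    -- Let X consist of the vertices of U with an in-neighbour on the cycle C, and let x ⟶ y be an
    -- arc leaving X. If x has an out-neighbour on C, it is inserted. Otherwise y lies in U outside
    -- X, all of C has arcs to x, and y has arcs to all of C, so x and y together go into the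
    -- closing arc.
    grow : ∀ m {c cs ℓ} U → length U ≤ m → Run c cs ℓ → Closed c ℓ → (c ∷ cs) ++ U ↭ xs → Cycle xs
    grow m [] _ r cl perm = _ , _ , _ , r , cl , subst (_↭ xs) (++-identityʳ _) perm
    grow (suc m) {c} {cs} {ℓ} U@(w ∷ _) len r cl perm = go
      where
      C : List V
      C = c ∷ cs
      uCU : Unique (C ++ U)
      uCU = unique-↭ (↭-sym perm) uniq
      C⊆ : ∀ {v} → v ∈ C → v ∈ xs
      C⊆ v∈ = ∈-resp-↭ perm (∈-++⁺ˡ v∈)
      U⊆ : ∀ {v} → v ∈ U → v ∈ xs
      U⊆ v∈ = ∈-resp-↭ perm (∈-++⁺ʳ C v∈)
      C⊎U : ∀ {v} → v ∈ xs → v ∈ C ⊎ v ∈ U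
      C⊎U v∈ = ∈-++⁻ C (∈-resp-↭ (↭-sym perm) v∈)
      semi-C : ∀ {x} → x ∈ U → Semi x C
      semi-C x∈ y∈ = semi (U⊆ x∈) (C⊆ y∈) λ { refl → unique-disjoint C uCU y∈ x∈ }
      from to : V → Bool
      from v = does (1 ≤? count (λ p → p ⇒ v) C)
      to v = does (1 ≤? count (λ q → v ⇒ q) C)
      from⁻ : ∀ {v} → from v ≡ true → ∃ λ p → p ∈ C × p ⟶ v
      from⁻ {v} e = ∃-count C (does-true (1 ≤? count (λ p → p ⇒ v) C) e)
      from⁺ : ∀ {p v} → p ∈ C → p ⟶ v → from v ≡ true
      from⁺ {p} {v} p∈ e = dec-true (1 ≤? count (λ p → p ⇒ v) C) (count>0 C p∈ e)
      to⁻ : ∀ {v} → to v ≡ true → ∃ λ q → q ∈ C × v ⟶ q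
      to⁻ {v} e = ∃-count C (does-true (1 ≤? count (λ q → v ⇒ q) C) e)
      to⁺ : ∀ {q v} → q ∈ C → v ⟶ q → to v ≡ true
      to⁺ {q} {v} q∈ e = dec-true (1 ≤? count (λ q → v ⇒ q) C) (count>0 C q∈ e)
      smaller : ∀ {x U′} → U ↭ x ∷ U′ → length U′ ≤ m
      smaller p = ≤-pred (≤-trans (≤-reflexive (sym (↭-length p))) len)
      X : V → Bool
      X v = mem U v ∧ from v
      c∉U : mem U c ≡ false
      c∉U = ∉⇒mem (λ c∈ → unique-disjoint C uCU (here refl) c∈)
      go : Cycle xs
      -- An arc leaving C shows that X is inhabited; c lies outside X, so strength can be applied to
      -- X too.
      go with strong (mem C) (C⊆ (here refl)) (mem⁺ {C} (here refl)) (U⊆ (here refl))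
                (∉⇒mem {C} (λ w∈ → unique-disjoint C uCU w∈ (here refl)))
      ... | p , u , p∈ , pC , u∈ , uC , p⟶u
        with strong X u∈ (∧-join (mem⁺ ([ (λ h → ⊥-elim (mem⇒∉ {C} uC h)) , id ]′ (C⊎U u∈)))
                                 (from⁺ (mem⁻ {C} pC) p⟶u))
                   (C⊆ (here refl)) (cong (_∧ from c) c∉U)
      ... | x , y , x∈ , Xx , y∈ , Xy , x⟶y with ∧-split {mem U x} Xx
      ... | Ux , fx with from⁻ {x} fx | extract (mem⁻ {U} Ux) | bool (to x)
      ... | p′ , p′∈ , p′⟶x | U′ , permU | inj₁ tx with to⁻ {x} tx
      ...   | q , q∈ , x⟶q with insert-cycle r cl p′∈ p′⟶x q∈ x⟶q (semi-C (mem⁻ {U} Ux))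
      ...     | c₁ , cs₁ , ℓ₁ , r₁ , cl₁ , perm₁ = grow m U′ (smaller permU) r₁ cl₁
                  (↭-trans (++⁺ʳ U′ perm₁)
                  (↭-trans (↭-sym (shift x C U′)) (↭-trans (++⁺ˡ C (↭-sym permU)) perm)))
      go | p , u , p∈ , pC , u∈ , uC , p⟶u | x , y , x∈ , Xx , y∈ , Xy , x⟶y | Ux , fx
        | p′ , p′∈ , p′⟶x | U′ , permU | inj₂ tx
        with C⊎U y∈
      ... | inj₁ y∈C = true≢false (to⁺ y∈C x⟶y) tx
      ... | inj₂ y∈U with ∈-resp-↭ permU y∈U
      ...   | here refl = true≢false Xx Xy
      ...   | there y∈U′ with extract y∈U′
      ...     | U″ , permU′ = grow m U″
                  (≤-trans (≤-trans (n≤1+n _) (≤-reflexive (sym (↭-length permU′)))) (smaller permU))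
                  (run-++ r (ℓ⟶x ∷ x⟶y ∷ stop)) (inj₂ y⟶c)
                  (↭-trans (↭-reflexive (++-assoc C (x ∷ y ∷ []) U″))
                  (↭-trans (++⁺ˡ C (↭-trans (prep x (↭-sym permU′)) (↭-sym permU))) perm))
        where
        ℓ⟶x : ℓ ⟶ x
        ℓ⟶x = [ (λ e → true≢false (to⁺ (run-last r) e) tx) , id ]′ (semi-C (mem⁻ {U} Ux) (run-last r))
        fy : from y ≡ false
        fy = ¬true⇒false (λ e → true≢false (∧-join (mem⁺ y∈U) e) Xy)
        y⟶c : y ⟶ c
        y⟶c = [ id , (λ e → true≢false (from⁺ (here refl) e) fy) ]′ (semi-C y∈U (here refl))

  ham-cycle : ∀ xs → 0 < length xs → Unique xs → Semicomplete-on xs → Strong-on xs → Cycle xs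
  ham-cycle (x ∷ xs) _ u semi strong =
    Camion.grow (x ∷ xs) u semi strong (length xs) xs ≤-refl stop (inj₁ refl) ↭-refl

  Split : (f h : V → Bool) → V → List V → V → Set
  Split f h c cs ℓ = ∃₂ λ ys m → ∃₂ λ z zs →
    cs ≡ ys ++ z ∷ zs × Run c ys m × h m ≡ true × f z ≡ true × Run z zs ℓ

  -- If no arc fits, `h` of the tail and `f` of the head add up to at most 1 for every arc of the
  -- run. The `h` of the last vertex belongs to no arc, hence the extra `𝟙 (h ℓ)`.
  find-split : ∀ (f h : V → Bool) {c cs ℓ} → Run c cs ℓ →
               Split f h c cs ℓ ⊎ count f cs + count h (c ∷ cs) ≤ length cs + 𝟙 (h ℓ)
  find-split f h {c} stop = inj₂ (≤-reflexive (+-identityʳ (𝟙 (h c))))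
  find-split f h {c} {d ∷ ds} {ℓ} (e ∷ r) with bool (h c ∧ f d)
  ... | inj₁ hf with ∧-split {h c} hf
  ...   | hc , fd = inj₁ ([] , c , d , ds , refl , stop , hc , fd , r)
  find-split f h {c} {d ∷ ds} {ℓ} (e ∷ r) | inj₂ hf with find-split f h r
  ... | inj₁ (ys , m , z , zs , eq , run , rest) = inj₁ (d ∷ ys , m , z , zs , cong (d ∷_) eq , e ∷ run , rest)
  ... | inj₂ le = inj₂ (lin _ _ 0 (le ⊕ 𝟙-∧ (h c) (f d) hf)
                    (arith (𝟙 (f d)) (count f ds) (𝟙 (h c)) (count h (d ∷ ds)) (length ds) (𝟙 (h ℓ))))
    where
    𝟙-∧ : ∀ a b → a ∧ b ≡ false → 𝟙 a + 𝟙 b ≤ 1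
    𝟙-∧ true false _ = ≤-refl
    𝟙-∧ false true _ = ≤-refl
    𝟙-∧ false false _ = z≤n
    arith : ∀ fd cf hc ch l t → fd + cf + (hc + ch) + (l + t + 1) + 0 ≡ suc l + t + (cf + ch + (hc + fd))
    arith = solve-∀

  -- The same count around the whole cycle, where the closing arc pairs `h ℓ` with `f c`. If it is
  -- that arc which fits, the cycle is already cut in the right place.
  rotate : ∀ (f h : V → Bool) {xs} → Cycle xs → Unique xs → length xs < count f xs + count h xs →
           ∃ λ r → ∃₂ λ rs e → r ∷ rs ↭ xs × Run r rs e × f r ≡ true × h e ≡ true
  rotate f h {xs} (c , cs , ℓ , run , closed , perm) u big with find-split f h run
  ... | inj₁ (ys , m , z , zs , refl , run₁ , hm , fz , run₂) with closed
  ...   | inj₂ ℓ⟶c = z , zs ++ c ∷ ys , m , ↭-trans (++-comm (z ∷ zs) (c ∷ ys)) perm ,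
                     run-++ run₂ (ℓ⟶c ∷ run₁) , fz , hm
  -- A cycle closed by equality has one vertex only, but here ℓ ≡ c occurs again in `z ∷ zs`.
  ...   | inj₁ refl = ⊥-elim (unique-disjoint (c ∷ []) (unique-↭ (↭-sym perm) u) (here refl)
                        (∈-++⁺ʳ ys (run-last run₂)))
  rotate f h {xs} (c , cs , ℓ , run , closed , perm) u big | inj₂ le = go
    where
    𝟙≤1 : ∀ b → 𝟙 b ≤ 1
    𝟙≤1 true = ≤-refl
    𝟙≤1 false = z≤n
    arith : ∀ fc cf ch l hl → fc + cf + ch + (l + hl + 1) + 0 ≡ suc l + (cf + ch + (fc + hl))
    arith = solve-∀
    few : 𝟙 (f c) + 𝟙 (h ℓ) ≤ 1 → count f xs + count h xs ≤ length xs
    few le₁ = subst₂ _≤_ (cong₂ _+_ (Σ-↭ perm) (Σ-↭ perm)) (↭-length perm)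
      (lin _ _ 0 (le ⊕ le₁) (arith (𝟙 (f c)) (count f cs) (count h (c ∷ cs)) (length cs) (𝟙 (h ℓ))))
    go : _
    go with bool (f c) | bool (h ℓ)
    ... | inj₁ fc | inj₁ hℓ = c , cs , ℓ , perm , run , fc , hℓ
    ... | inj₁ fc | inj₂ hℓ = ⊥-elim (<⇒≱ big (few (≤-reflexive (cong₂ (λ a b → 𝟙 a + 𝟙 b) fc hℓ))))
    ... | inj₂ fc | _ = ⊥-elim (<⇒≱ big (few (≤-trans (≤-reflexive (cong (λ a → 𝟙 a + 𝟙 (h ℓ)) fc)) (𝟙≤1 (h ℓ)))))

  -- The interior vertices of each detour join the forbidden list before the next detour is sought;
  -- the budget M reserves two vertices for every entry of S still to come.
  realize : ∀ {Compat : V → V → Set} {OK : V → Set} {M} →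
    (∀ {u v} F → length F ≤ M → Unique F → Compat u v →
      ∃ λ w → Path u w v × length w ≤ 2 × Unique (w ++ F) × All OK w) →
    ∀ {u S ℓ} F → Unique F → length F + 2 * length S ≤ M → Chain Compat u S ℓ →
    ∃₂ λ W S′ → Run u S′ ℓ × S′ ↭ S ++ W × length W ≤ 2 * length S × Unique (W ++ F) × All OK W
  realize conn F uF le stop = [] , [] , stop , ↭-refl , z≤n , uF , []
  realize conn {u} {v ∷ S} F uF le (c ∷ ch)
    with conn F (≤-trans (m≤m+n (length F) _) le) uF c
  ... | w , path , w≤2 , u₁ , ok₁ with realize conn (w ++ F) u₁ le′ ch
    where
    arith : ∀ a b l m → a + b + 2 * l + (2 + m) + 0 ≡ m + (a + (b + 2 * suc l))
    arith = solve-∀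
    le′ : length (w ++ F) + 2 * length S ≤ _
    le′ = subst (λ z → z + 2 * length S ≤ _) (sym (length-++ w))
      (lin _ _ 0 (w≤2 ⊕ le) (arith (length w) (length F) (length S) _))
  ...   | W , S′ , run , perm , W≤ , u₂ , ok₂ =
    W ++ w , w ++ v ∷ S′ , path-run w path run ,
    ↭-trans (shift v w S′) (prep v (↭-trans (++-comm w S′)
      (↭-trans (++⁺ʳ w perm) (↭-reflexive (++-assoc S W w))))) ,
    subst (_≤ _) (sym (length-++ W)) (lin _ _ 0 (W≤ ⊕ w≤2) (arith (length W) (length w) (length S))) ,
    subst Unique (sym (++-assoc W w F)) u₂ , All.++⁺ ok₂ ok₁
    where
    arith : ∀ a b l → a + b + (2 * l + 2) + 0 ≡ 2 * suc l + (a + b)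
    arith = solve-∀

-- From a Hamiltonian trail to a path cover

∈-concat : ∀ {A : Set} {v : A} pss → v ∈ concat pss → ∃ λ p → p ∈ pss × v ∈ p
∈-concat pss v∈ with ∈-concat⁻′ pss v∈
... | p , v∈p , p∈ = p , p∈ , v∈p

unique-++ˡ : ∀ {A : Set} (as : List A) {bs} → Unique (as ++ bs) → Unique as
unique-++ˡ [] u = []
unique-++ˡ (a ∷ as) (a≢ ∷ u) = All.++⁻ˡ as a≢ ∷ unique-++ˡ as u

unique-++ʳ : ∀ {A : Set} (as : List A) {bs} → Unique (as ++ bs) → Unique bs
unique-++ʳ [] u = u
unique-++ʳ (a ∷ as) (_ ∷ u) = unique-++ʳ as u

unique-part : ∀ {A : Set} {p : List A} pss → Unique (concat pss) → p ∈ pss → Unique p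
unique-part (p ∷ pss) u (here refl) = unique-++ˡ p u
unique-part (p ∷ pss) u (there p∈) = unique-part pss (unique-++ʳ p u) p∈

shared-part : ∀ {A : Set} {v : A} {p q : List A} pss → Unique (concat pss) →
          p ∈ pss → q ∈ pss → v ∈ p → v ∈ q → p ≡ q
shared-part (p ∷ pss) u (here refl) (here refl) _ _ = refl
shared-part (p ∷ pss) u (here refl) (there q∈) v∈p v∈q =
  ⊥-elim (unique-disjoint p u v∈p (∈-concat⁺′ v∈q q∈))
shared-part (p ∷ pss) u (there p∈) (here refl) v∈p v∈q =
  ⊥-elim (unique-disjoint p u v∈q (∈-concat⁺′ v∈p p∈))
shared-part (p ∷ pss) u (there p∈) (there q∈) v∈p v∈q = shared-part pss (unique-++ʳ p u) p∈ q∈ v∈p v∈q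

module Trail {n : ℕ} (D : Digraph n) (s : Fin n) (T : List (Fin n)) where
  open Counting {n}
  module G = Walks (arc D)

  source : V → V
  source u = if mem T u then s else u

  -- Leaving a vertex of T means restarting at s, so a single walk through all vertices other
  -- than s that ends in T encodes a system of paths from s to T.
  _⇒ᵀ_ : V → V → Bool
  u ⇒ᵀ v = arc D (source u) v

  module H = Walks _⇒ᵀ_

  source-∈ : ∀ {u} → u ∈ T → source u ≡ s
  source-∈ u∈ rewrite mem⁺ {T} u∈ = refl

  source-∉ : ∀ {u} → u ∉ T → source u ≡ u
  source-∉ u∉ rewrite ∉⇒mem {T} u∉ = refl

  source-s : source s ≡ s
  source-s with mem T s
  ... | true = refl
  ... | false = refl

  lift-path : ∀ {u v} W → All (_∉ T) W → G.Path (source u) W v → H.Path u W v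
  lift-path [] [] e = e
  lift-path {v = v} (x ∷ W) (x∉ ∷ a) (e , p) = e , lift-path W a (subst (λ y → G.Path y W v) (sym (source-∉ x∉)) p)

  lift-run : ∀ {u W v} → All (_∉ T) (u ∷ W) → G.Run u W v → H.Run u W v
  lift-run a stop = stop
  lift-run (u∉ ∷ a) (e ∷ r) = subst (λ y → arc D y _ ≡ true) (sym (source-∉ u∉)) e ∷ lift-run a r

  Piece : Set
  Piece = List V × V

  whole : Piece → List V
  whole (Q , q) = Q ++ q ∷ []

  Leg : V → Piece → Set
  Leg u (Q , q) = G.Path u Q q × q ∈ T × All (_∉ T) Q

  -- The run is cut after every vertex of T. All pieces but the first start at s because that is the
  -- source of a vertex of T, and `ℓ ∈ T` completes the last piece.
  pieces : ∀ {u v L ℓ} → H.Run u (v ∷ L) ℓ → ℓ ∈ T →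
           ∃₂ λ p ps → v ∷ L ≡ concat (map whole (p ∷ ps)) × Leg (source u) p × All (Leg s) ps
  pieces {v = v} (e ∷ r) ℓ∈ with _∈?_ _≟ᶠ_ v T
  pieces {v = v} (e ∷ stop) ℓ∈ | yes v∈ = ([] , v) , [] , refl , (e , v∈ , []) , []
  pieces {v = v} (e ∷ (d ∷ r)) ℓ∈ | yes v∈ with pieces (d ∷ r) ℓ∈
  ... | p , ps , eq , leg , legs =
    ([] , v) , p ∷ ps , cong (v ∷_) eq , (e , v∈ , []) , subst (λ y → Leg y p) (source-∈ v∈) leg ∷ legs
  pieces {v = v} (e ∷ stop) ℓ∈ | no v∉ = ⊥-elim (v∉ ℓ∈)
  pieces {v = v} (e ∷ (d ∷ r)) ℓ∈ | no v∉ with pieces (d ∷ r) ℓ∈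
  ... | (Q , q) , ps , eq , (path , q∈ , Q∉) , legs =
    (v ∷ Q , q) , ps , cong (v ∷_) eq ,
    ((e , subst (λ y → G.Path y Q q) (source-∉ v∉) path) , q∈ , v∉ ∷ Q∉) , legs

  path-walk : ∀ {u} Q {q} → G.Path u Q q → Walk D (u ∷ Q ++ q ∷ [])
  path-walk [] e = step e (single _)
  path-walk (x ∷ Q) (e , p) = step e (path-walk Q p)

  last-∷ʳ : ∀ (u : V) Q {q} → last (u ∷ Q ++ q ∷ []) ≡ just q
  last-∷ʳ u [] = refl
  last-∷ʳ u (x ∷ Q) = last-∷ʳ x Q

Cover : ∀ {n} → Digraph n → (k : ℕ) → Fin n → (Fin k → Fin n) → Set
Cover {n} D k s t =
  Σ (Fin k → List (Fin n)) λ P →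
    (∀ i → IsPath D s (t i) (P i)) ×
    (∀ i j → i ≢ j → ∀ v → v ∈ P i → v ∈ P j → v ≡ s) ×
    (∀ v → ∃ λ i → v ∈ P i)

-- A piece meets T only in its last vertex and always ends there, so each target ends exactly one
-- piece and each piece belongs to a target; the pieces need not be counted.
cover : ∀ {n k} (D : Digraph n) (s : Fin n) (t : Fin (suc k) → Fin n) → Injective _≡_ _≡_ t → (∀ i → t i ≢ s) →
        let T = tabulate t in
        ∀ {L ℓ} → Trail.H.Run D s T s L ℓ → ℓ ∈ T → s ∷ L ↭ allFin n → Cover D (suc k) s t
cover {n} {k} D s t t-inj t≢s {[]} stop ℓ∈ perm with ∈-tabulate⁻ {f = t} ℓ∈
... | i , s≡ti = ⊥-elim (t≢s i (sym s≡ti))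
cover {n} {k} D s t t-inj t≢s {v₀ ∷ L₀} run ℓ∈ perm with Trail.pieces D s (tabulate t) run ℓ∈
... | p₀ , ps₀ , eq , leg₀ , legs₀ = P , is-path , disjoint , covers
  where
  open Counting {n}
  open Trail D s (tabulate t)
  L : List V
  L = v₀ ∷ L₀
  ps : List Piece
  ps = p₀ ∷ ps₀
  legs : All (Leg s) ps
  legs = subst (λ y → Leg y p₀) source-s leg₀ ∷ legs₀
  unique-sL : Unique (s ∷ L)
  unique-sL = unique-↭ (↭-sym perm) (Unique.allFin⁺ n)
  s∉L : s ∉ L
  s∉L = Unique.Unique[x∷xs]⇒x∉xs unique-sL
  unique-ps : Unique (concat (map whole ps))
  unique-ps = subst Unique eq (unique-++ʳ (s ∷ []) unique-sL)
  ∈L : ∀ {v} → v ≢ s → v ∈ L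
  ∈L {v} v≢s with ∈-resp-↭ (↭-sym perm) (∈V v)
  ... | here v≡s = ⊥-elim (v≢s v≡s)
  ... | there v∈ = v∈
  find-piece : ∀ {v} → v ≢ s → ∃ λ p → p ∈ ps × v ∈ whole p
  find-piece v≢s with ∈-concat (map whole ps) (subst (_ ∈_) eq (∈L v≢s))
  ... | w , w∈ , v∈ with ∈-map⁻ whole w∈
  ...   | p , p∈ , refl = p , p∈ , v∈
  piece : ∀ i → ∃ λ Q → (Q , t i) ∈ ps
  piece i with find-piece (t≢s i)
  ... | (Q , q) , p∈ , ti∈ with ∈-++⁻ Q ti∈
  ...   | inj₁ ti∈Q = ⊥-elim (All.lookup (proj₂ (proj₂ (All.lookup legs p∈))) ti∈Q (∈-tabulate⁺ {f = t} i))
  ...   | inj₂ (here refl) = Q , p∈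
  W : Fin (suc k) → List V
  W i = whole (proj₁ (piece i) , t i)
  W∈ : ∀ i → W i ∈ map whole ps
  W∈ i = ∈-map⁺ whole (proj₂ (piece i))
  P : Fin (suc k) → List V
  P i = s ∷ W i
  is-path : ∀ i → IsPath D s (t i) (P i)
  is-path i = record
    { walk = path-walk (proj₁ (piece i)) (proj₁ (All.lookup legs (proj₂ (piece i))))
    ; unique = All.tabulate (λ { {v} v∈ refl → s∉L (subst (s ∈_) (sym eq) (∈-concat⁺′ v∈ (W∈ i))) })
             ∷ unique-part (map whole ps) unique-ps (W∈ i)
    ; starts = W i , refl
    ; ends = last-∷ʳ s (proj₁ (piece i)) }
  ends-equal : ∀ (Q Q′ : List V) {q q′} → Q ++ q ∷ [] ≡ Q′ ++ q′ ∷ [] → q ≡ q′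
  ends-equal Q Q′ e with ∷ʳ-injective Q Q′ e
  ... | _ , q≡ = q≡
  disjoint : ∀ i j → i ≢ j → ∀ v → v ∈ P i → v ∈ P j → v ≡ s
  disjoint i j i≢j v (here v≡s) _ = v≡s
  disjoint i j i≢j v (there _) (here v≡s) = v≡s
  disjoint i j i≢j v (there v∈i) (there v∈j) = ⊥-elim (i≢j (t-inj
    (ends-equal (proj₁ (piece i)) (proj₁ (piece j))
      (shared-part (map whole ps) unique-ps (W∈ i) (W∈ j) v∈i v∈j))))
  covers : ∀ v → ∃ λ i → v ∈ P i
  covers v with v ≟ᶠ s
  -- s lies on every path; index `zero` is a default.
  ... | yes v≡s = zero , here v≡s
  ... | no v≢s with find-piece v≢s
  ...   | (Q , q) , p∈ , v∈ with ∈-tabulate⁻ {f = t} (proj₁ (proj₂ (All.lookup legs p∈)))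
  ...     | i , refl = i , there (subst (v ∈_) (shared-part (map whole ps) unique-ps
              (∈-map⁺ whole p∈) (W∈ i) (∈-++⁺ʳ Q (here refl)) (∈-++⁺ʳ (proj₁ (piece i)) (here refl))) v∈)

-- Small cuts

module _ {n : ℕ} where
  open Counting {n}

  enumeration : ∀ {xs : List V} → Unique xs → (∀ v → v ∈ xs) → xs ↭ allFin n
  enumeration u all = ∼bag⇒↭ (unique∧set⇒bag u (Unique.allFin⁺ n) (mk⇔ (λ _ → ∈V _) (λ _ → all _)))

  chain-last : ∀ {R : V → V → Set} {u S ℓ} → Chain R u S ℓ → ℓ ∈ u ∷ S
  chain-last stop = here refl
  chain-last (_ ∷ c) = there (chain-last c)

  -- Connectivity in positive form: were there no arc from X to Y, the at most K vertices outside
  -- both would separate them.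
  NoSmallCut : (V → V → Bool) → ℕ → Set
  NoSmallCut _⇒_ K = ∀ (X Y : V → Bool) → (∀ v → X v ≡ true → Y v ≡ true → ⊥) →
    0 < # X → 0 < # Y → n ≤ # X + # Y + K →
    ∃₂ λ x y → X x ≡ true × Y y ≡ true × (x ⇒ y) ≡ true

  record SmallCut (_⇒_ : V → V → Bool) (K : ℕ) : Set where
    field
      A B      : V → Bool
      disjoint : ∀ v → A v ≡ true → B v ≡ true → ⊥
      A-inhab  : 0 < # A
      B-inhab  : 0 < # B
      small    : n ≤ # A + # B + K
      no-arc   : ∀ x y → A x ≡ true → B y ≡ true → (x ⇒ y) ≡ false

  Separates : (V → V → Bool) → ℕ → (V → Bool) → (V → Bool) → Set
  Separates _⇒_ K A B = (∀ v → A v ∧ B v ≡ false) × 0 < # A × 0 < # B × n ≤ # A + # B + K ×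
    (∀ x y → A x ∧ B y ∧ (x ⇒ y) ≡ false)

  -- Decided by searching all pairs of subsets, which is why `Separates` uses Boolean equations and
  -- the sets pass through vectors.
  cut-dichotomy : ∀ _⇒_ K → NoSmallCut _⇒_ K ⊎ SmallCut _⇒_ K
  cut-dichotomy _⇒_ K
    with anySubset? (λ X → anySubset? (λ Y → separates? (Vec.lookup X) (Vec.lookup Y)))
    where
    separates? : ∀ A B → Dec (Separates _⇒_ K A B)
    separates? A B = all? (λ v → _ ≟ᵇ _) ×-dec (_ ≤? _) ×-dec (_ ≤? _) ×-dec (_ ≤? _) ×-dec
                     all? (λ x → all? (λ y → _ ≟ᵇ _))
  ... | yes (X , Y , dis , x>0 , y>0 , le , none) = inj₂ (record
    { A = Vec.lookup X ; B = Vec.lookup Y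
    ; disjoint = λ v Xv Yv → true≢false (∧-join Xv Yv) (dis v)
    ; A-inhab = x>0 ; B-inhab = y>0 ; small = le
    ; no-arc = λ x y Xx Yy → ¬true⇒false (λ e → true≢false (∧-join Xx (∧-join Yy e)) (none x y)) })
  ... | no ¬cut = inj₁ arc-across
    where
    arc-across : NoSmallCut _⇒_ K
    arc-across X Y dis x>0 y>0 le
      with any? (λ x → any? (λ y → (X x ≟ᵇ true) ×-dec (Y y ≟ᵇ true) ×-dec ((x ⇒ y) ≟ᵇ true)))
    ... | yes r = r
    ... | no ¬arc = ⊥-elim (¬cut (Vec.tabulate X , Vec.tabulate Y ,
      (λ v → subst₂ (λ a b → a ∧ b ≡ false) (sym (lookup∘tabulate X v)) (sym (lookup∘tabulate Y v))
        (¬true⇒false (λ e → dis v (proj₁ (∧-split e)) (proj₂ (∧-split {X v} e))))) ,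
      ≤-trans x>0 (same X) , ≤-trans y>0 (same Y) ,
      ≤-trans le (same X ⊕ same Y ⊕ ≤-refl) ,
      λ x y → subst₂ (λ a b → a ∧ b ∧ (x ⇒ y) ≡ false) (sym (lookup∘tabulate X x)) (sym (lookup∘tabulate Y y))
        (¬true⇒false (λ e → ¬arc (x , y , proj₁ (∧-split e) , ∧-split {Y y} (proj₂ (∧-split {X x} e)))))))
      where
      same : ∀ Z → # Z ≤ # (Vec.lookup (Vec.tabulate Z))
      same Z = #-mono (λ v Zv → trans (lookup∘tabulate Z v) Zv)

module Regroup {A : Set} where
  private module CM = Algebra.Solver.CommutativeMonoid (++-commutativeMonoid {A = A})
  open CM using (_⊜_) renaming (_⊕_ to _∙_)

  regroup₁ : ∀ (s w₁ a w₂ R t T W : List A) →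
    s ++ ((w₁ ++ a ++ w₂) ++ R) ++ t ++ T ++ W ↭ (s ++ a ++ t ++ T ++ W ++ w₂ ++ w₁) ++ R
  regroup₁ = CM.solve 8 (λ s w₁ a w₂ R t T W →
    (s ∙ (((w₁ ∙ (a ∙ w₂)) ∙ R) ∙ (t ∙ (T ∙ W)))) ⊜ ((s ∙ (a ∙ (t ∙ (T ∙ (W ∙ (w₂ ∙ w₁)))))) ∙ R)) ↭-refl

  regroup₂ : ∀ (s w₁ a w₂ R t T W : List A) →
    s ++ (w₁ ++ R) ++ a ++ w₂ ++ t ++ T ++ W ↭ (s ++ a ++ t ++ T ++ W ++ w₂ ++ w₁) ++ R
  regroup₂ = CM.solve 8 (λ s w₁ a w₂ R t T W →
    (s ∙ ((w₁ ∙ R) ∙ (a ∙ (w₂ ∙ (t ∙ (T ∙ W)))))) ⊜ ((s ∙ (a ∙ (t ∙ (T ∙ (W ∙ (w₂ ∙ w₁)))))) ∙ R)) ↭-refl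

open Regroup

-- No small cut

module HighlyConnected where

  module _ {n : ℕ} (D : Digraph n) (semi : Semicomplete D) (s t₁ : Fin n) (T′ : List (Fin n)) (k : ℕ)
    (#T : length (t₁ ∷ T′) ≡ k) (uniq-sT : Unique (s ∷ t₁ ∷ T′))
    (2≤k : 2 ≤ k) (big : k * 1000 ≤ n) (δ : ℕ) (half : n + k ≤ 1 + (δ + δ))
    (out : ∀ u → δ ≤ Counting.#_ (λ v → arc D u v)) (inn : ∀ v → δ ≤ Counting.#_ (λ u → arc D u v))
    (no-cut : NoSmallCut (arc D) (k * 10)) where

    open Counting {n}
    T : List V
    T = t₁ ∷ T′
    open Trail D s T

    outside : List V → V → Bool
    outside F v = not (mem F v)

    outside⁻ : ∀ {F v} → outside F v ≡ true → v ∉ F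
    outside⁻ e = mem⇒∉ (not-true e)

    remove : ∀ (p : V → Bool) F → # p ≤ # (λ v → outside F v ∧ p v) + # (mem F)
    remove p F = #-cover cov
      where
      cov : ∀ v → p v ≡ true → outside F v ∧ p v ≡ true ⊎ mem F v ≡ true
      cov v pv with mem F v
      ... | true = inj₂ refl
      ... | false = inj₁ pv

    trim : ∀ (p : V → Bool) F → # p ≤ # (λ v → outside F v ∧ p v) + length F
    trim p F = ≤-trans (remove p F) (+-monoʳ-≤ _ (#-mem F))

    -- With no common neighbour left, the out-neighbours of u and the in-neighbours of v outside F
    -- are disjoint and miss at most 10k vertices, so an arc joins the two sets.
    connect : ∀ u v F → length F ≤ k * 5 → ∃ λ w → G.Path u w v × length w ≤ 2 × Unique w × All (_∉ F) w
    connect u v F le with bool (arc D u v)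
    ... | inj₁ uv = [] , uv , z≤n , [] , []
    ... | inj₂ _ with any? (λ x → (outside F x ∧ arc D u x) ≟ᵇ true ×-dec (outside F x ∧ arc D x v) ≟ᵇ true)
    ...   | yes (x , ux , xv) = x ∷ [] , (proj₂ (∧-split {outside F x} ux) , proj₂ (∧-split {outside F x} xv)) ,
                                s≤s z≤n , [] ∷ [] , outside⁻ (proj₁ (∧-split ux)) ∷ []
    ...   | no ¬common with no-cut (λ x → outside F x ∧ arc D u x) (λ y → outside F y ∧ arc D y v)
              (λ x ux xv → ¬common (x , ux , xv))
              (room k half (≤-trans (out u) (trim _ F)) le big 2≤k)
              (room k half (≤-trans (inn v) (trim _ F)) le big 2≤k)
              (no-gap k half (≤-trans (out u) (trim _ F)) (≤-trans (inn v) (trim _ F)) le 2≤k)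
    ...     | x , y , ux , yv , xy = x ∷ y ∷ [] ,
      (proj₂ (∧-split {outside F x} ux) , xy , proj₂ (∧-split {outside F y} yv)) , ≤-refl ,
      ((λ { refl → ¬common (x , ux , yv) }) ∷ []) ∷ [] ∷ [] ,
      outside⁻ (proj₁ (∧-split ux)) ∷ outside⁻ (proj₁ (∧-split yv)) ∷ []

    -- A Hamiltonian cycle of the remaining vertices has an arc e r with s → r and e → t₁ or e → a as
    -- soon as these two sets of candidates together outnumber the cycle; without a one may just miss.
    Good : V → Set
    Good a = a ∉ s ∷ T × n + k * 6 ≤ # (arc D s) + # (λ v → arc D v t₁ ∨ arc D v a)

    -- If no a adds 6k new in-neighbours, let L be the set of vertices without an arc to t₁. Either
    -- L is so small that t₁ alone suffices and any a will do, or L has at least 24k vertices. Then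
    -- too many arcs go from L to the vertices outside `s ∷ T`, each of which receives fewer than
    -- 6k.
    good-vertex : ∃ Good
    good-vertex with any? (λ a → (outside (s ∷ T) a ≟ᵇ true) ×-dec
                            (k * 6 ≤? # (λ v → not (arc D v t₁) ∧ arc D v a)))
    ... | yes (a , a∉ , many) = a , outside⁻ a∉ , gain k half (out s) (inn t₁)
            (#-disjoint (λ v → ∨-inl) (λ v e → ∨-inr {arc D v t₁} (proj₂ (∧-split {not (arc D v t₁)} e)))
              (λ v e e′ → true≢false e (not-true (proj₁ (∧-split e′))))) many 2≤k
    ... | no none with # (λ v → not (arc D v t₁)) + k * 6 ≤? δ
    ...   | yes few with pick {λ _ → true} {mem (s ∷ T)}
                (≤-trans (spare k (≤-trans (#-mem (s ∷ T)) (≤-reflexive (cong suc #T))) big 2≤k)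
                  (≤-reflexive (sym #-total)))
    ...     | a , _ , a∉ = a , mem⇒∉ a∉ ,
                dominating k {l = # (λ v → not (arc D v t₁))}
                  (≤-trans (≤-reflexive (sym #-total)) (#-cover {λ _ → true} (λ v _ → split v)))
                  few (out s)
      where
      split : ∀ v → arc D v t₁ ∨ arc D v a ≡ true ⊎ not (arc D v t₁) ≡ true
      split v with arc D v t₁
      ... | true = inj₁ refl
      ... | false = inj₂ refl
    good-vertex | no none | no ¬few = ⊥-elim (n≮0 (clash k (≤-trans product counted) 2≤k))
      where
      L : V → Bool
      L v = not (arc D v t₁)
      -- At most 1 + k out-neighbours are lost to `s ∷ T`.
      p : ℕ
      p = δ ∸ (1 + k)
      p+ : ∀ u → p ≤ # (λ y → outside (s ∷ T) y ∧ arc D u y)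
      p+ u = ≤-trans (∸-monoˡ-≤ (1 + k) (≤-trans (out u) (trim (arc D u) (s ∷ T))))
        (≤-reflexive (trans (cong (λ z → N + suc z ∸ (1 + k)) #T) (m+n∸n≡m N (1 + k))))
        where
        N : ℕ
        N = # (λ y → outside (s ∷ T) y ∧ arc D u y)
      counted : # L * p ≤ n * (k * 6)
      counted = ≤-trans (double-count (arc D) L (outside (s ∷ T)) p (k * 6) (λ u _ → p+ u)
                  (λ y y∉ → <⇒≤ (≰⇒> (λ many → none (y , y∉ , many)))))
                (*-monoˡ-≤ (k * 6) (#≤n _))
      p-large : 1 + n ≤ 4 * p
      p-large = large-factor k half (m≤n+m∸n′ δ (1 + k)) big 2≤k
        where
        m≤n+m∸n′ : ∀ m j → m ≤ m ∸ j + j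
        m≤n+m∸n′ m j = ≤-trans (m≤n+m∸n m j) (≤-reflexive (+-comm j (m ∸ j)))
      -- 24 = 4 · 6: since 4p > n, already 24k vertices of L send out at least (1 + n) · 6k arcs.
      product : (1 + n) * (k * 6) ≤ # L * p
      product = ≤-trans (*-monoˡ-≤ (k * 6) p-large)
        (≤-trans (≤-reflexive (regroup k p)) (*-monoˡ-≤ p (large-rest k half big (≰⇒> ¬few))))
        where
        regroup : ∀ k p → 4 * p * (k * 6) ≡ k * 24 * p
        regroup = solve-∀

    -- Here any two vertices can be linked, so the targets may come in any order.
    chain-⊤ : ∀ {u : V} S → ∃ λ ℓ → Chain (λ _ _ → ⊤) u S ℓ
    chain-⊤ [] = _ , stop
    chain-⊤ (x ∷ S) with chain-⊤ S
    ... | ℓ , c = ℓ , tt ∷ c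

    module _ (a : V) (a∉ : a ∉ s ∷ T) (many : n + k * 6 ≤ # (arc D s) + # (λ v → arc D v t₁ ∨ arc D v a)) where

      B : List V
      B = s ∷ a ∷ T

      -- Two vertices each for the detours from s to a and from a to t₁, and two for each of the
      -- other k - 1 targets.
      M : ℕ
      M = k * 2 + 2

      #B : ∀ F → length F ≤ M → length (B ++ F) ≤ k * 5
      #B F le = ≤-trans (≤-reflexive (trans (length-++ B) (cong (λ z → 2 + z + length F) #T))) (fits k le 2≤k)

      -- Forbidding B too keeps detours away from all their ends, and from T, so that they lift to
      -- the trail.
      link : ∀ u v F → length F ≤ M → Unique F →
             ∃ λ w → G.Path u w v × length w ≤ 2 × Unique (w ++ F) × All (_∉ B) w
      link u v F le uF with connect u v (B ++ F) (#B F le)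
      ... | w , path , w≤2 , uw , w∉ = w , path , w≤2 ,
        Unique.++⁺ uw uF (λ (x∈w , x∈F) → All.lookup w∉ x∈w (∈-++⁺ʳ B x∈F)) ,
        All.map (λ x∉ x∈ → x∉ (∈-++⁺ˡ x∈)) w∉

      ∉B⇒∉T : ∀ {w} → All (_∉ B) w → All (_∉ T) w
      ∉B⇒∉T = All.map (λ x∉ x∈ → x∉ (there (there x∈)))

      H-link : ∀ {u v} F → length F ≤ M → Unique F → ⊤ →
               ∃ λ w → H.Path u w v × length w ≤ 2 × Unique (w ++ F) × All (_∉ B) w
      H-link {u} {v} F le uF tt with link (source u) v F le uF
      ... | w , path , rest@(_ , _ , w∉) = w , lift-path w (∉B⇒∉T w∉) path , rest

      uniq-B : Unique B
      uniq-B = insert uniq-sT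
        where
        insert : Unique (s ∷ T) → Unique B
        insert (s≢ ∷ uT) = ((λ s≡a → a∉ (here (sym s≡a))) ∷ s≢) ∷
                           All.tabulate (λ { x∈ refl → a∉ (there x∈) }) ∷ uT

      -- The parts before and after a stay separate, since it is not yet known how much of the path
      -- from s to t₁ will be merged.
      skeleton : ∃₂ λ w₁ w₂ → ∃₂ λ W S → ∃ λ ℓ →
        G.Path s w₁ a × G.Path a w₂ t₁ × H.Run t₁ S ℓ × ℓ ∈ T × S ↭ T′ ++ W ×
        Unique (W ++ (w₂ ++ w₁)) × All (_∉ B) (W ++ (w₂ ++ w₁)) × length (W ++ (w₂ ++ w₁)) ≤ M
      skeleton =
        case link s a [] z≤n [] of λ { (w₁ , path₁ , w₁≤2 , u₁ , ok₁) →
        case link a t₁ w₁ (≤-trans w₁≤2 (m≤n+m 2 (k * 2))) (subst Unique (++-identityʳ w₁) u₁) of λ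
          { (w₂ , path₂ , w₂≤2 , u₂ , ok₂) →
        case chain-⊤ {t₁} T′ of λ { (ℓ , chain) →
        case H.realize {OK = _∉ B} {M = M} H-link (w₂ ++ w₁) u₂
               (subst (λ z → z + 2 * length T′ ≤ M) (sym (length-++ w₂)) (tail-fits k w₁≤2 w₂≤2 (≤-reflexive #T)))
               chain of λ { (W , S , run , perm , W≤ , uW , okW) →
          w₁ , w₂ , W , S , ℓ , path₁ , path₂ , run , chain-last chain , perm , uW ,
          All.++⁺ okW (All.++⁺ ok₂ ok₁) ,
          subst (_≤ M) (sym (trans (length-++ W) (cong (length W +_) (length-++ w₂))))
            (all-fit k w₁≤2 w₂≤2 (≤-reflexive #T) W≤) } } } }

      semi-distinct : ∀ {xs} → G.Semicomplete-on xs
      semi-distinct {x = x} {y} _ _ x≢y = semi x y x≢y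

      module Rest (F : List V) (uF : Unique F) (okF : All (_∉ B) F) (F≤ : length F ≤ M) where
        BF R : List V
        BF = B ++ F
        R = sel (outside BF)
        R∉ : ∀ {v} → v ∈ R → v ∉ BF
        R∉ v∈ = outside⁻ (∈-sel⁻ {outside BF} v∈)
        BF≤ : length BF ≤ k * 5
        BF≤ = #B F F≤
        n≤ : n ≤ # (outside BF) + length BF
        n≤ = ≤-trans (≤-reflexive (sym #-total)) (≤-trans (trim (λ _ → true) BF)
               (+-monoˡ-≤ _ (#-mono (λ v e → proj₁ (∧-split e)))))
        -- The two parts of R miss only the at most 5k vertices of `BF`, so `no-cut` applies to
        -- them.
        strong : G.Strong-on R
        strong X {a} {b} a∈ Xa b∈ Xb
          with no-cut (λ v → outside BF v ∧ X v) (λ v → outside BF v ∧ not (X v))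
                 (λ v e e′ → true≢false (proj₂ (∧-split {outside BF v} e)) (not-true (proj₂ (∧-split {outside BF v} e′))))
                 (#-singleton a (∧-join (∈-sel⁻ {outside BF} a∈) Xa))
                 (#-singleton b (∧-join (∈-sel⁻ {outside BF} b∈) (not-false Xb)))
                 (still-small k {x = # (λ v → outside BF v ∧ X v)} {p = # (outside BF)}
                   n≤
                   (#-cover (λ v e → cases v e)) BF≤ 2≤k)
          where
          cases : ∀ v → outside BF v ≡ true →
                  outside BF v ∧ X v ≡ true ⊎ outside BF v ∧ not (X v) ≡ true
          cases v e with X v
          ... | true = inj₁ (∧-join e refl)
          ... | false = inj₂ (∧-join e refl)
        ... | x , y , ex , ey , xy = x , y , ∈-sel⁺ (proj₁ (∧-split ex)) , proj₂ (∧-split {outside BF x} ex) ,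
              ∈-sel⁺ (proj₁ (∧-split ey)) , not-true (proj₂ (∧-split {outside BF y} ey)) , xy
        uniq-R : Unique R
        uniq-R = sel-unique (outside BF)
        rotation : ∃ λ r → ∃₂ λ rs e → r ∷ rs ↭ R × G.Run r rs e × arc D s r ≡ true ×
                   (arc D e t₁ ∨ arc D e a) ≡ true
        rotation = G.rotate (arc D s) (λ e → arc D e t₁ ∨ arc D e a)
          (G.ham-cycle R nonempty uniq-R semi-distinct strong) uniq-R count-big
          where
          count-big : length R < count (arc D s) R + count (λ e → arc D e t₁ ∨ arc D e a) R
          count-big = subst₂ _<_ (sym (length-sel (outside BF)))
            (sym (cong₂ _+_ (count-select _ (outside BF) (allFin n)) (count-select _ (outside BF) (allFin n))))
            (exceeds k {m = # (mem BF)} many (remove _ BF) (remove _ BF)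
              (≤-trans (#-disjoint {r = λ _ → true} (λ _ _ → refl) (λ _ _ → refl)
                (λ v e e′ → true≢false e′ (not-true e))) (≤-reflexive #-total))
              (≤-trans (#-mem BF) BF≤) 2≤k)
          nonempty : 0 < length R
          nonempty = ≤-trans (remaining k n≤ BF≤ big 2≤k) (≤-reflexive (sym (length-sel (outside BF))))
        all-vertices : BF ++ R ↭ allFin n
        all-vertices = enumeration
          (Unique.++⁺ (Unique.++⁺ uniq-B uF (λ (x∈B , x∈F) → All.lookup okF x∈F x∈B)) uniq-R
            (λ (x∈ , x∈R) → R∉ x∈R x∈))
          covered
          where
          covered : ∀ v → v ∈ BF ++ R
          covered v with bool (mem BF v)
          ... | inj₁ e = ∈-++⁺ˡ (mem⁻ {BF} e)
          ... | inj₂ e = ∈-++⁺ʳ BF (∈-sel⁺ (not-false e))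

      module Close {w₁ w₂ W S ℓ} (path₁ : G.Path s w₁ a) (path₂ : G.Path a w₂ t₁) (run : H.Run t₁ S ℓ)
        (ℓ∈ : ℓ ∈ T) (permS : S ↭ T′ ++ W) (uF : Unique (W ++ (w₂ ++ w₁)))
        (okF : All (_∉ B) (W ++ (w₂ ++ w₁))) (F≤ : length (W ++ (w₂ ++ w₁)) ≤ M) where
        open Rest (W ++ (w₂ ++ w₁)) uF okF F≤
        ∉T : ∀ {v} → v ∈ w₂ ++ w₁ → v ∉ T
        ∉T v∈ v∈T = All.lookup okF (∈-++⁺ʳ W v∈) (there (there v∈T))
        R∉T : ∀ {v} → v ∈ R → v ∉ T
        R∉T v∈ v∈T = R∉ v∈ (∈-++⁺ˡ (there (there v∈T)))
        rejoin : ∀ X {rs v} → (∀ {x} → x ∈ X → x ∈ BF × x ∉ T) → rs ↭ R →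
                 G.Path s X v → G.Path s rs v → ∃ λ M → M ↭ X ++ R × H.Path s M v
        rejoin X {rs} {v} X-old permR p q
          with G.merge X rs (λ x∈ r∈ → semi _ _ λ { refl → R∉ (∈-resp-↭ permR r∈) (proj₁ (X-old x∈)) }) p q
        ... | M , permM , path = M , permM′ , lift-path M (All.tabulate M∉T) (subst (λ y → G.Path y M v) (sym source-s) path)
          where
          permM′ : M ↭ X ++ R
          permM′ = ↭-trans permM (++⁺ˡ X permR)
          M∉T : ∀ {x} → x ∈ M → x ∉ T
          M∉T x∈ = [ (λ x∈X → proj₂ (X-old x∈X)) , R∉T ]′ (∈-++⁻ X (∈-resp-↭ permM′ x∈))
        ∈F : ∀ {v} → v ∈ w₂ ++ w₁ → v ∈ BF
        ∈F v∈ = ∈-++⁺ʳ B (∈-++⁺ʳ W v∈)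
        old₁ : ∀ {v} → v ∈ w₁ → v ∈ BF × v ∉ T
        old₁ v∈ = ∈F (∈-++⁺ʳ w₂ v∈) , ∉T (∈-++⁺ʳ w₂ v∈)
        old₂ : ∀ {v} → v ∈ a ∷ w₂ → v ∈ BF × v ∉ T
        old₂ (here refl) = there (here refl) , λ a∈ → a∉ (there a∈)
        old₂ (there v∈) = ∈F (∈-++⁺ˡ v∈) , ∉T (∈-++⁺ˡ v∈)
        close : ∃₂ λ L ℓ → H.Run s L ℓ × ℓ ∈ T × s ∷ L ↭ allFin n
        close =
          case rotation of λ { (r , rs , e , permR , runR , s⟶r , e⟶) →
            -- A path ending at t₁ is merged with the whole path through a; one ending at a only
            -- with the part before a.
            [ (λ e⟶t₁ → close₁ permR (s⟶r , G.run-path runR e⟶t₁))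
            , (λ e⟶a → close₂ permR (s⟶r , G.run-path runR e⟶a)) ]′ (∨-split {arc D e t₁} e⟶) }
          where
          close₁ : ∀ {rs} → rs ↭ R → G.Path s rs t₁ → ∃₂ λ L ℓ → H.Run s L ℓ × ℓ ∈ T × s ∷ L ↭ allFin n
          close₁ permR path =
            case rejoin (w₁ ++ a ∷ w₂) (λ v∈ → [ old₁ , old₂ ]′ (∈-++⁻ w₁ v∈)) permR
                   (G.path-++ w₁ path₁ path₂) path of λ { (M , permM , path′) →
               M ++ t₁ ∷ S , ℓ , H.path-run M path′ run , ℓ∈ ,
               ↭-trans (prep s (++⁺ permM (prep t₁ permS)))
                 (↭-trans (regroup₁ (s ∷ []) w₁ (a ∷ []) w₂ R (t₁ ∷ []) T′ W) all-vertices) }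
          close₂ : ∀ {rs} → rs ↭ R → G.Path s rs a → ∃₂ λ L ℓ → H.Run s L ℓ × ℓ ∈ T × s ∷ L ↭ allFin n
          close₂ permR path =
            case rejoin w₁ old₁ permR path₁ path of λ { (M , permM , path′) →
               M ++ a ∷ (w₂ ++ t₁ ∷ S) , ℓ ,
               H.path-run M path′ (H.path-run w₂
                 (lift-path w₂ (All.tabulate (λ v∈ → ∉T (∈-++⁺ˡ v∈)))
                   (subst (λ y → G.Path y w₂ t₁) (sym (source-∉ (proj₂ (old₂ (here refl))))) path₂)) run) ,
               ℓ∈ ,
               ↭-trans (prep s (++⁺ permM (prep a (++⁺ˡ w₂ (prep t₁ permS)))))
                 (↭-trans (regroup₂ (s ∷ []) w₁ (a ∷ []) w₂ R (t₁ ∷ []) T′ W) all-vertices) }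

      trail : ∃₂ λ L ℓ → H.Run s L ℓ × ℓ ∈ T × s ∷ L ↭ allFin n
      trail = case skeleton of λ
        { (w₁ , w₂ , W , S , ℓ , path₁ , path₂ , run , ℓ∈ , permS , uF , okF , F≤) →
          Close.close path₁ path₂ run ℓ∈ permS uF okF F≤ }

    hamiltonian-trail : ∃₂ λ L ℓ → H.Run s L ℓ × ℓ ∈ T × s ∷ L ↭ allFin n
    hamiltonian-trail with good-vertex
    ... | a , a∉ , many = trail a a∉ many

-- A small cut

module Side {n : ℕ} (_⇒_ : Fin n → Fin n → Bool) (loopless : ∀ v → (v ⇒ v) ≡ false)
  (semi : ∀ u v → u ≢ v → (u ⇒ v) ≡ true ⊎ (v ⇒ u) ≡ true)
  (A B special : Fin n → Bool) (disjoint : ∀ v → A v ≡ true → B v ≡ true → ⊥)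
  (no-arc : ∀ x y → A x ≡ true → B y ≡ true → (x ⇒ y) ≡ false)
  (A-inhab : 0 < Counting.#_ A) (B-inhab : 0 < Counting.#_ B)
  (k : ℕ) (2≤k : 2 ≤ k) (big : k * 1000 ≤ n) (big² : k * k * 4232 ≤ n)
  (small : n ≤ Counting.#_ A + Counting.#_ B + k * 10) (few-special : Counting.#_ special ≤ k * 2)
  (δ : ℕ) (half : n + k ≤ 1 + (δ + δ))
  (out : ∀ u → δ ≤ Counting.#_ (λ v → u ⇒ v)) (inn : ∀ v → δ ≤ Counting.#_ (λ u → u ⇒ v)) where

  open Counting {n}
  open Walks _⇒_

  C : V → Bool
  C v = not (A v) ∧ not (B v)

  C-few : # C ≤ k * 10
  C-few = few-outside k {A = # A} small (≤-trans
    (+-monoˡ-≤ (# C) (#-disjoint {A} {B} {λ v → A v ∨ B v} (λ v → ∨-inl) (λ v → ∨-inr) disjoint))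
    (≤-trans (#-disjoint {r = λ _ → true} (λ _ _ → refl) (λ _ _ → refl) apart) (≤-reflexive #-total)))
    where
    apart : ∀ v → A v ∨ B v ≡ true → C v ≡ true → ⊥
    apart v e e′ with ∧-split {not (A v)} e′
    ... | ¬a , ¬b = [ (λ a → true≢false a (not-true ¬a)) , (λ b → true≢false b (not-true ¬b)) ]′ (∨-split e)

  side : ∀ v → A v ≡ true ⊎ B v ≡ true ⊎ C v ≡ true
  side v with A v | B v
  ... | true | _ = inj₁ refl
  ... | false | true = inj₂ (inj₁ refl)
  ... | false | false = inj₂ (inj₂ refl)

  inA outB : V → ℕ
  inA v = # (λ u → A u ∧ (u ⇒ v))
  outB v = # (λ u → B u ∧ (v ⇒ u))

  -- 70 exceeds 22 (fringe) + 24 (vertices in use) + 20 (misses of a core vertex in A and outside A ∪ B).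
  fromA toB : V → Bool
  fromA v = does (k * 70 ≤? inA v)
  toB v = does (k * 70 ≤? outB v)

  fromA⁻ : ∀ {v} → fromA v ≡ true → k * 70 ≤ inA v
  fromA⁻ {v} = does-true (k * 70 ≤? inA v)

  does-false : ∀ {P : Set} (d : Dec P) → does d ≡ false → ¬ P
  does-false (no ¬p) _ = ¬p

  inA-low : ∀ {v} → fromA v ≡ false → inA v ≤ k * 70
  inA-low {v} e = <⇒≤ (≰⇒> (does-false (k * 70 ≤? inA v) e))

  outB-low : ∀ {v} → toB v ≡ false → outB v ≤ k * 70
  outB-low {v} e = <⇒≤ (≰⇒> (does-false (k * 70 ≤? outB v) e))

  B⇒¬fromA : ∀ {v} → B v ≡ true → fromA v ≡ false
  B⇒¬fromA {v} Bv = ¬true⇒false λ e → positive (≤-trans (fromA⁻ e) (≤-reflexive none))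
    where
    none : inA v ≡ 0
    none = count-none (allFin n) (λ {u} _ → ¬true⇒false λ e →
             true≢false (proj₂ (∧-split {A u} e)) (no-arc u v (proj₁ (∧-split e)) Bv))
    positive : k * 70 ≤ 0 → ⊥
    positive le = n≮0 (≤-trans (≤-trans 2≤k (m≤m*n k 70)) le)

  A⇒¬toB : ∀ {v} → A v ≡ true → toB v ≡ false
  A⇒¬toB {v} Av = ¬true⇒false λ e → positive (≤-trans (does-true (k * 70 ≤? outB v) e) (≤-reflexive none))
    where
    none : outB v ≡ 0
    none = count-none (allFin n) (λ {u} _ → ¬true⇒false λ e →
             true≢false (proj₂ (∧-split {B u} e)) (no-arc v u Av (proj₁ (∧-split e))))
    positive : k * 70 ≤ 0 → ⊥
    positive le = n≮0 (≤-trans (≤-trans 2≤k (m≤m*n k 70)) le)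

  -- The in-neighbours of a vertex of B all lie outside A.
  A+δ≤n : # A + δ ≤ n
  A+δ≤n with ∃-count (allFin n) B-inhab
  ... | b , _ , Bb = ≤-trans (+-monoʳ-≤ (# A) (inn b))
    (≤-trans (#-disjoint {r = λ _ → true} (λ _ _ → refl) (λ _ _ → refl)
      (λ v Av e → true≢false e (no-arc v b Av Bb))) (≤-reflexive #-total))

  missed : V → V → Bool
  missed u v = A v ∧ not (u ⇒ v)

  hit+missed : ∀ u → # (λ v → A v ∧ (u ⇒ v)) + # (missed u) ≤ # A
  hit+missed u = #-disjoint (λ v e → proj₁ (∧-split e)) (λ v e → proj₁ (∧-split e))
    (λ v e e′ → true≢false (proj₂ (∧-split {A v} e)) (not-true (proj₂ (∧-split {A v} e′))))

  A-δ : δ ≤ # A + k * 10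
  A-δ with ∃-count (allFin n) A-inhab
  ... | a , _ , Aa = ≤-trans (out a) (≤-trans (#-cover cov) (+-monoʳ-≤ (# A) C-few))
    where
    cov : ∀ v → (a ⇒ v) ≡ true → A v ≡ true ⊎ C v ≡ true
    cov v e = [ inj₁ , [ (λ Bv → true≢false e (no-arc a v Aa Bv)) , inj₂ ]′ ]′ (side v)

  A-large : k * 200 ≤ # A
  A-large = side-large k half A-δ big 2≤k

  -- A has at most n - δ vertices, and a has at least δ - 10k out-neighbours among them; the
  -- difference is below 10k since n < 2δ.
  missed-A : ∀ {a} → A a ≡ true → # (missed a) ≤ k * 10
  missed-A {a} Aa = misses-core k half A+δ≤n (≤-trans (out a) (#-cover cov)) C-few (hit+missed a) 2≤k
    where
    cov : ∀ v → (a ⇒ v) ≡ true → A v ∧ (a ⇒ v) ≡ true ⊎ C v ≡ true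
    cov v e = [ (λ Av → inj₁ (∧-join Av e)) , [ (λ Bv → true≢false e (no-arc a v Aa Bv)) , inj₂ ]′ ]′ (side v)

  -- As for `missed-A`, with up to 70k further out-neighbours in B.
  missed-low : ∀ {u} → toB u ≡ false → # (missed u) ≤ k * 80
  missed-low {u} low = misses-low k half A+δ≤n
    (≤-trans (out u) (≤-trans (#-cover cov) (+-monoʳ-≤ _ (#-∨ (λ v → B v ∧ (u ⇒ v)) C))))
    (outB-low low) C-few (hit+missed u) 2≤k
    where
    cov : ∀ v → (u ⇒ v) ≡ true → A v ∧ (u ⇒ v) ≡ true ⊎ (B v ∧ (u ⇒ v)) ∨ C v ≡ true
    cov v e = [ (λ Av → inj₁ (∧-join Av e)) , [ (λ Bv → inj₂ (∨-inl (∧-join Bv e))) ,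
                (λ Cv → inj₂ (∨-inr {B v ∧ (u ⇒ v)} Cv)) ]′ ]′ (side v)

  poor : V → Bool
  poor v = A v ∧ not (fromA v)

  -- Each vertex of A misses at most 10k poor vertices, and each poor vertex receives at most 70k
  -- arcs from A. More than 20k poor vertices would give 200k · p ≤ 2p · 70k for p = `# poor` - 10k.
  poor-few : # poor ≤ k * 20
  poor-few with # poor ≤? k * 20
  ... | yes le = le
  ... | no ¬le = ⊥-elim (n≮0 (too-many k {p} (≤-trans lower upper) (*-mono-≤ (≤-trans (s≤s z≤n) 2≤k) p≥1)))
    where
    p : ℕ
    p = # poor ∸ k * 10
    poor≤ : # poor ≤ p + k * 10
    poor≤ = ≤-trans (m≤n+m∸n (# poor) (k * 10)) (≤-reflexive (+-comm (k * 10) p))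
    p≥1 : 1 ≤ p
    p≥1 = leftover k (≰⇒> ¬le) poor≤ 2≤k
    counted : # A * p ≤ # poor * (k * 70)
    counted = double-count _⇒_ A poor p (k * 70)
      (λ a Aa → ≤-trans (∸-monoˡ-≤ (k * 10) (≤-trans (#-cover (cov a)) (+-monoʳ-≤ _ (missed-A Aa))))
                        (≤-reflexive (m+n∸n≡m _ (k * 10))))
      (λ y py → inA-low (not-true (proj₂ (∧-split {A y} py))))
      where
      cov : ∀ a v → poor v ≡ true → poor v ∧ (a ⇒ v) ≡ true ⊎ missed a v ≡ true
      cov a v e with bool (a ⇒ v)
      ... | inj₁ h = inj₁ (∧-join e h)
      ... | inj₂ h = inj₂ (∧-join (proj₁ (∧-split e)) (not-false h))
    lower : k * 200 * p ≤ # A * p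
    lower = *-monoˡ-≤ p A-large
    upper : # A * p ≤ k * 140 * p
    upper = ≤-trans counted (≤-trans (*-monoˡ-≤ (k * 70) (doubles k (≰⇒> ¬le) poor≤)) (≤-reflexive (regroup k p)))
      where
      regroup : ∀ k p → (p + p) * (k * 70) ≡ k * 140 * p
      regroup = solve-∀

  -- The supply of detour vertices; s and T may not be used up by detours.
  core : V → Bool
  core v = A v ∧ (fromA v ∧ not (special v))

  core-A : ∀ {v} → core v ≡ true → A v ≡ true
  core-A e = proj₁ (∧-split e)

  core-fromA : ∀ {v} → core v ≡ true → fromA v ≡ true
  core-fromA {v} e = proj₁ (∧-split (proj₂ (∧-split {A v} e)))

  core-ordinary : ∀ {v} → core v ≡ true → special v ≡ false
  core-ordinary {v} e = not-true (proj₂ (∧-split {fromA v} (proj₂ (∧-split {A v} e))))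

  fringe : V → Bool
  fringe v = A v ∧ not (core v)

  fringe-few : # fringe ≤ k * 22
  fringe-few = add-special k (#-cover cov) poor-few few-special
    where
    cov : ∀ v → fringe v ≡ true → poor v ≡ true ⊎ special v ≡ true
    cov v e with A v | fromA v | special v
    ... | true | false | _ = inj₁ refl
    ... | true | true | true = inj₂ refl
    cov v () | true | true | false
    cov v () | false | _ | _

  -- If all out-neighbours of a core vertex a lie in `fromA`, then a itself provides the extra 1.
  -- Otherwise every core vertex has an arc to one of at most 30k vertices with at most 70k
  -- in-neighbours in A each, which leaves room for only 2100k² core vertices.
  fromA-large : 1 + δ ≤ # fromA
  fromA-large with any? (λ a → (core a ≟ᵇ true) ×-dec (# (λ v → low v ∧ (a ⇒ v)) ≤? 0))
    where
    low : V → Bool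
    low v = not (fromA v) ∧ not (B v)
  ... | yes (a , core-a , none) = ≤-trans (+-mono-≤ (#-singleton a {λ v → does (v ≟ᶠ a)} (dec-true (a ≟ᶠ a) refl)) (out a))
    (#-disjoint (λ v e → subst (λ z → fromA z ≡ true) (sym (does-true (v ≟ᶠ a) e)) (core-fromA core-a)) out⊆
      (λ v e e′ → true≢false (subst (λ z → (a ⇒ z) ≡ true) (does-true (v ≟ᶠ a) e) e′) (loopless a)))
    where
    out⊆ : ∀ v → (a ⇒ v) ≡ true → fromA v ≡ true
    out⊆ v e with bool (fromA v) | bool (B v)
    ... | inj₁ h | _ = h
    ... | inj₂ h | inj₁ Bv = true≢false e (no-arc a v (core-A core-a) Bv)
    ... | inj₂ h | inj₂ Bv = ⊥-elim (n≮0 (≤-trans (#-singleton v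
            (∧-join (∧-join (not-false h) (not-false Bv)) e)) none))
  ... | no ¬typical = ⊥-elim (n≮0 (core-large k counted cover-A A-δ half big² k²-large 2≤k))
    where
    low : V → Bool
    low v = not (fromA v) ∧ not (B v)
    low-few : # low ≤ k * 30
    low-few = add-outside k (#-cover cov) poor-few C-few
      where
      cov : ∀ v → low v ≡ true → poor v ≡ true ⊎ C v ≡ true
      cov v e with A v | B v | fromA v
      ... | true | false | false = inj₁ refl
      ... | false | false | false = inj₂ refl
      cov v () | _ | true | false
      cov v () | _ | _ | true
    k²-large : k * 64 ≤ k * k * 32
    k²-large = ≤-trans (≤-reflexive (sym (*-assoc k 2 32))) (*-monoˡ-≤ 32 (*-monoʳ-≤ k 2≤k))
    counted : # core * 1 ≤ k * 30 * (k * 70)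
    counted = ≤-trans (double-count _⇒_ core low 1 (k * 70)
      (λ a core-a → ≰⇒> (λ none → ¬typical (a , core-a , none)))
      (λ y low-y → ≤-trans (#-mono (λ v e → ∧-join (core-A (proj₁ (∧-split e))) (proj₂ (∧-split {core v} e))))
                     (inA-low (not-true (proj₁ (∧-split low-y))))))
      (*-monoˡ-≤ (k * 70) low-few)
    cover-A : # A ≤ # core + k * 22
    cover-A = ≤-trans (#-cover cov) (+-monoʳ-≤ (# core) fringe-few)
      where
      cov : ∀ v → A v ≡ true → core v ≡ true ⊎ fringe v ≡ true
      cov v e with bool (core v)
      ... | inj₁ h = inj₁ h
      ... | inj₂ h = inj₂ (∧-join e (not-false h))

  -- 46 = 22 + 24 pays for the fringe and for the vertices of F.
  pick-core : ∀ (p q : V → Bool) (F : List V) → length F ≤ k * 24 → k * 46 + # q + 1 ≤ # (λ v → A v ∧ p v) →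
              ∃ λ v → core v ≡ true × p v ≡ true × q v ≡ false × v ∉ F
  pick-core p q F F≤ le with pick {λ v → A v ∧ p v} {λ v → fringe v ∨ (q v ∨ mem F v)}
    (pick-room k le fringe-few F≤ (≤-trans (#-∨ fringe _) (+-monoʳ-≤ _ (≤-trans (#-∨ q (mem F)) (+-monoʳ-≤ _ (#-mem F))))))
  ... | v , Apv , e with ∧-split {A v} Apv
  ...   | Av , pv = v , core-v , pv , ¬true⇒false (λ h → true≢false (∨-inr {fringe v} (∨-inl h)) e) ,
                    mem⇒∉ (¬true⇒false (λ h → true≢false (∨-inr {fringe v} (∨-inr {q v} h)) e))
    where
    core-v : core v ≡ true
    core-v with bool (core v)
    ... | inj₁ h = h
    ... | inj₂ h = true≢false (∨-inl (∧-join Av (not-false h))) e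

  A∧ : ∀ v → A v ≡ true → A v ∧ true ≡ true
  A∧ v e = ∧-join e refl

  hit : ∀ {u v} → A v ≡ true → missed u v ≡ false → u ⟶ v
  hit {u} {v} Av e with u ⇒ v
  ... | true = refl
  ... | false = true≢false (∧-join Av refl) e

  into-core : ∀ {u} F → length F ≤ k * 24 → toB u ≡ false → ∃ λ x → core x ≡ true × u ⟶ x × x ∉ F
  into-core {u} F F≤ low =
    let x , core-x , _ , ¬missed , x∉ = pick-core (λ _ → true) (missed u) F F≤
          (≤-trans (room-low k (missed-low low) A-large 2≤k) (#-mono A∧))
    in x , core-x , hit (core-A core-x) ¬missed , x∉

  #-none : # (λ _ → false) ≤ k * 20
  #-none = ≤-trans (≤-reflexive (count-none (allFin n) (λ _ → refl))) z≤n

  from-core : ∀ {v} F → length F ≤ k * 24 → fromA v ≡ true → ∃ λ y → core y ≡ true × y ⟶ v × y ∉ F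
  from-core {v} F F≤ from =
    let y , core-y , y⟶v , _ , y∉ = pick-core (λ u → u ⇒ v) (λ _ → false) F F≤
          (room-in k #-none (fromA⁻ from) 2≤k)
    in y , core-y , y⟶v , y∉

  any-core : ∀ F → length F ≤ k * 24 → ∃ λ y → core y ≡ true × y ∉ F
  any-core F F≤ =
    let y , core-y , _ , _ , y∉ = pick-core (λ _ → true) (λ _ → false) F F≤
          (≤-trans (room-low k (≤-trans #-none (*-monoʳ-≤ k (m≤m+n 20 60))) A-large 2≤k) (#-mono A∧))
    in y , core-y , y∉

  through-core : ∀ {u v} F → length F ≤ k * 24 → toB u ≡ false → fromA v ≡ true →
    ∃₂ λ x y → core x ≡ true × core y ≡ true × u ⟶ x × x ⟶ y × y ⟶ v × x ∉ F × y ∉ F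
  through-core {u} {v} F F≤ low from =
    let x , core-x , u⟶x , x∉ = into-core F F≤ low
        y , core-y , y⟶v , ¬missed , y∉ = pick-core (λ y → y ⇒ v) (missed x) F F≤
          (room-in k (≤-trans (missed-A (core-A core-x)) (*-monoʳ-≤ k (m≤m+n 10 10))) (fromA⁻ from) 2≤k)
    in x , y , core-x , core-y , u⟶x , hit (core-A core-y) ¬missed , y⟶v , x∉ , y∉

  -- The vertices to be absorbed on the A side, including those outside A and B that behave like
  -- vertices of A.
  A⁺ : V → Bool
  A⁺ v = (fromA v ∧ not (toB v)) ∧ not (special v)

  core⇒A⁺ : ∀ {v} → core v ≡ true → A⁺ v ≡ true
  core⇒A⁺ e = ∧-join (∧-join (core-fromA e) (not-false (A⇒¬toB (core-A e)))) (not-false (core-ordinary e))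

  A⁺-side : ∀ {v} → A⁺ v ≡ true → A v ≡ true ⊎ C v ≡ true
  A⁺-side {v} e = [ inj₁ , [ (λ Bv → true≢false (proj₁ (∧-split {fromA v} (proj₁ (∧-split e)))) (B⇒¬fromA Bv)) , inj₂ ]′ ]′ (side v)

  module Absorb (F : List V) (F≤ : length F ≤ k * 24) where

    rest : V → Bool
    rest v = not (mem F v) ∧ A⁺ v

    core-rest : ∀ {v} → core v ≡ true → v ∉ F → rest v ≡ true
    core-rest e v∉ = ∧-join (not-false (∉⇒mem v∉)) (core⇒A⁺ e)

    rest-A⁺ : ∀ {v} → rest v ≡ true → A⁺ v ≡ true
    rest-A⁺ {v} e = proj₂ (∧-split {not (mem F v)} e)

    missed-rest : ∀ {x} → A x ≡ true → ∀ (q : V → Bool) → (∀ v → q v ≡ true → rest v ≡ true × (x ⇒ v) ≡ false) → # q ≤ k * 20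
    missed-rest {x} Ax q h = sum-twenty k (#-cover cov) (missed-A Ax) C-few
      where
      cov : ∀ v → q v ≡ true → missed x v ≡ true ⊎ C v ≡ true
      cov v e = Data.Sum.map (λ Av → ∧-join Av (not-false (proj₂ (h v e)))) id (A⁺-side (rest-A⁺ (proj₁ (h v e))))

    strong : Strong-on (sel rest)
    strong X {a} {b} a∈ Xa b∈ Xb
      with any? (λ x → any? (λ y → (rest x ≟ᵇ true) ×-dec (X x ≟ᵇ true) ×-dec (rest y ≟ᵇ true) ×-dec
                                   (X y ≟ᵇ false) ×-dec ((x ⇒ y) ≟ᵇ true)))
    ... | yes (x , y , rx , Xx , ry , Xy , xy) = x , y , ∈-sel⁺ rx , Xx , ∈-sel⁺ ry , Xy , xy
    ... | no ¬arc = ⊥-elim (absurd (any? (λ x → (rest x ≟ᵇ true) ×-dec (X x ≟ᵇ true) ×-dec (A x ≟ᵇ true))))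
      where
      unless : ∀ v → core v ≡ true → v ∉ F → rest v ∧ not (X v) ≡ false → X v ≡ true
      unless v core-v v∉ e with X v
      ... | true = refl
      ... | false = true≢false (∧-join (core-rest core-v v∉) refl) e
      absurd : Dec (∃ λ x → rest x ≡ true × X x ≡ true × A x ≡ true) → ⊥
      absurd (yes (x , rx , Xx , Ax)) =
        let v , core-v , v⟶b , e , v∉ = pick-core (λ v → v ⇒ b) (λ v → rest v ∧ not (X v)) F F≤
              (room-in k (missed-rest Ax _ (λ v e → proj₁ (∧-split e) , ¬true⇒false (λ xv →
                  ¬arc (x , v , rx , Xx , proj₁ (∧-split e) , not-true (proj₂ (∧-split {rest v} e)) , xv))))
                (fromA⁻ (proj₁ (∧-split {fromA b} (proj₁ (∧-split (rest-A⁺ {b} (∈-sel⁻ {rest} b∈))))))) 2≤k)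
        in ¬arc (v , b , core-rest core-v v∉ , unless v core-v v∉ e , ∈-sel⁻ {rest} b∈ , Xb , v⟶b)
      absurd (no ¬A) =
        let v , core-v , a⟶v , v∉ = into-core F F≤
              (not-true (proj₂ (∧-split {fromA a} (proj₁ (∧-split (rest-A⁺ {a} (∈-sel⁻ {rest} a∈)))))))
        in ¬arc (a , v , ∈-sel⁻ {rest} a∈ , Xa , core-rest core-v v∉ ,
                 ¬true⇒false (λ Xv → ¬A (v , core-rest core-v v∉ , Xv , core-A core-v)) , a⟶v)

    -- α has arcs to all but 20k vertices of the cycle, while v keeps at least 70k - 22k - 24k
    -- in-neighbours on it; so the two sets together outnumber the cycle.
    absorb : ∀ {α v} → core α ≡ true → fromA v ≡ true → ∃ λ W → W ↭ sel rest × Path α W v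
    absorb {α} {v} core-α from =
      let r , rs , e , perm , run , α⟶r , e⟶v = rotate (λ r → α ⇒ r) (λ e → e ⇒ v)
            (ham-cycle (sel rest) nonempty (sel-unique rest) (λ {x} {y} _ _ → semi x y) strong)
            (sel-unique rest) many
      in r ∷ rs , perm , α⟶r , run-path run e⟶v
      where
      nonempty : 0 < length (sel rest)
      nonempty = let y , core-y , y∉ = any-core F F≤ in ≤-trans (#-singleton y (core-rest core-y y∉)) (≤-reflexive (sym (length-sel rest)))
      split-α : ∀ w → rest w ≡ true → rest w ∧ (α ⇒ w) ≡ true ⊎ rest w ∧ not (α ⇒ w) ≡ true
      split-α w e with bool (α ⇒ w)
      ... | inj₁ h = inj₁ (∧-join e h)
      ... | inj₂ h = inj₂ (∧-join e (not-false h))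
      split-v : ∀ w → A w ∧ (w ⇒ v) ≡ true → fringe w ≡ true ⊎ (rest w ∧ (w ⇒ v)) ∨ mem F w ≡ true
      split-v w e with bool (core w) | bool (mem F w)
      ... | inj₂ h | _ = inj₁ (∧-join (proj₁ (∧-split e)) (not-false h))
      ... | inj₁ h | inj₁ h′ = inj₂ (∨-inr {rest w ∧ (w ⇒ v)} h′)
      ... | inj₁ h | inj₂ h′ = inj₂ (∨-inl (∧-join (core-rest h (mem⇒∉ h′)) (proj₂ (∧-split {A w} e))))
      many : length (sel rest) < count (λ r → α ⇒ r) (sel rest) + count (λ e → e ⇒ v) (sel rest)
      many = subst₂ _<_ (sym (length-sel rest))
        (sym (cong₂ _+_ (count-select _ rest (allFin n)) (count-select _ rest (allFin n))))
        (absorbs k (#-cover split-α)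
          (missed-rest (core-A core-α) _ (λ w e → proj₁ (∧-split e) , not-true (proj₂ (∧-split {rest w} e))))
          (≤-trans (#-cover split-v) (+-monoʳ-≤ _ (≤-trans (#-∨ _ (mem F)) (+-monoʳ-≤ _ (#-mem F)))))
          (fromA⁻ from) fringe-few F≤ 2≤k)

module RegroupCut {A : Set} where
  private module CM = Algebra.Solver.CommutativeMonoid (++-commutativeMonoid {A = A})
  open CM using (_⊜_) renaming (_⊕_ to _∙_)

  regroup₃ : ∀ (P LB β R α LA vS W : List A) →
    P ++ LB ++ β ++ R ++ α ++ LA ++ vS ++ W ↭ (P ++ vS) ++ (LB ++ β ++ R ++ α ++ LA ++ W)
  regroup₃ = CM.solve 8 (λ P LB β R α LA vS W →
    (P ∙ (LB ∙ (β ∙ (R ∙ (α ∙ (LA ∙ (vS ∙ W))))))) ⊜ ((P ∙ vS) ∙ (LB ∙ (β ∙ (R ∙ (α ∙ (LA ∙ W))))))) ↭-refl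

  regroup₄ : ∀ (F Z T LB β R α LA W : List A) →
    (F ++ Z ++ T) ++ (LB ++ β ++ R ++ α ++ LA ++ W) ↭ T ++ Z ++ (α ++ β ++ W ++ F) ++ R ++ LA ++ LB
  regroup₄ = CM.solve 9 (λ F Z T LB β R α LA W →
    ((F ∙ (Z ∙ T)) ∙ (LB ∙ (β ∙ (R ∙ (α ∙ (LA ∙ W)))))) ⊜
    (T ∙ (Z ∙ ((α ∙ (β ∙ (W ∙ F))) ∙ (R ∙ (LA ∙ LB)))))) ↭-refl

open RegroupCut

select-split : ∀ {A : Set} (p : A → Bool) xs → xs ↭ select p xs ++ select (not ∘ p) xs
select-split p [] = ↭-refl
select-split p (x ∷ xs) with p x
... | true = prep x (select-split p xs)
... | false = ↭-trans (prep x (select-split p xs)) (↭-sym (shift x (select p xs) _))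

module _ {n : ℕ} (_⇒_ : Fin n → Fin n → Bool) where
  open Counting {n}
  private
    module W = Walks _⇒_
    module Wᵒ = Walks (flip _⇒_)

  reverse-path : ∀ {u} X {v} → Wᵒ.Path u X v → W.Path v (reverse X) u
  reverse-path [] e = e
  reverse-path {u} (x ∷ X) {v} (e , p) = subst (λ Y → W.Path v Y u) (sym (unfold-reverse x X))
    (W.path-++ (reverse X) (reverse-path X p) e)

-- The trail across a small cut

module Separable
  {n : ℕ} (D : Digraph n) (semi : Semicomplete D) (s : Fin n) (T : List (Fin n)) (k : ℕ)
  (#T : length T ≡ k) (uniq-sT : Unique (s ∷ T))
  (2≤k : 2 ≤ k) (big : k * 1000 ≤ n) (big² : k * k * 4232 ≤ n) (δ : ℕ) (half : n + k ≤ 1 + (δ + δ))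
  (out : ∀ u → δ ≤ Counting.#_ (λ v → arc D u v)) (inn : ∀ v → δ ≤ Counting.#_ (λ u → arc D u v))
  (cut : SmallCut (arc D) (k * 10)) where

  open Counting {n}
  open Trail D s T
  open SmallCut cut

  special : V → Bool
  special = mem (s ∷ T)

  few-special : # special ≤ k * 2
  few-special = double k (≤-trans (#-mem (s ∷ T)) (≤-reflexive (cong suc #T))) 2≤k

  module I = Side (arc D) (loopless D) (λ u v u≢v → semi u v u≢v) A B special disjoint no-arc A-inhab B-inhab
    k 2≤k big big² small few-special δ half out inn
  -- Reversing every arc and exchanging A with B gives the same situation again.
  module J = Side (flip (arc D)) (loopless D) (λ u v u≢v → Data.Sum.swap (semi u v u≢v)) B A special
    (λ v Bv Av → disjoint v Av Bv) (λ x y Bx Ay → no-arc y x Ay Bx) B-inhab A-inhab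
    k 2≤k big big² (≤-trans small (≤-reflexive (cong (_+ k * 10) (+-comm (# A) (# B))))) few-special
    δ half inn out

  fromA toB : V → Bool
  fromA = I.fromA
  toB = J.fromA

  OK : V → Set
  OK v = I.core v ≡ true ⊎ J.core v ≡ true

  OK-ordinary : ∀ {v} → OK v → special v ≡ false
  OK-ordinary = [ I.core-ordinary , J.core-ordinary ]′

  ordinary-∉T : ∀ {v} → special v ≡ false → v ∉ T
  ordinary-∉T e v∈ = mem⇒∉ {s ∷ T} e (there v∈)

  B⟶A : ∀ {x y} → J.core x ≡ true → I.core y ≡ true → arc D x y ≡ true
  B⟶A {x} {y} cx cy with semi x y (λ { refl → disjoint x (I.core-A cy) (J.core-A cx) })
  ... | inj₁ e = e
  ... | inj₂ e = true≢false e (no-arc y x (I.core-A cy) (J.core-A cx))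

  -- What a two-vertex detour requires: it may stay in A, stay in B, or go from B to A. Only leaving
  -- into A and arriving from B is excluded.
  Compat : V → V → Set
  Compat u v = fromA v ≡ true ⊎ toB (source u) ≡ true

  Detour : V → V → List V → Set
  Detour u v F = ∃₂ λ x y → OK x × OK y × arc D u x ≡ true × arc D x y ≡ true × arc D y v ≡ true × x ∉ F × y ∉ F

  detour : ∀ u v F → length F ≤ k * 24 → fromA v ≡ true ⊎ toB u ≡ true → Detour u v F
  detour u v F F≤ c with bool (fromA v) | bool (toB u)
  ... | inj₁ iA | inj₁ oB =
    let x , cx , ux , x∉ = J.from-core F F≤ oB
        y , cy , yv , y∉ = I.from-core F F≤ iA
    in x , y , inj₂ cx , inj₁ cy , ux , B⟶A cx cy , yv , x∉ , y∉
  ... | inj₁ iA | inj₂ ¬oB =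
    let x , y , cx , cy , ux , xy , yv , x∉ , y∉ = I.through-core F F≤ ¬oB iA
    in x , y , inj₁ cx , inj₁ cy , ux , xy , yv , x∉ , y∉
  ... | inj₂ ¬iA | inj₁ oB =
    let x , y , cx , cy , vx , xy , yu , x∉ , y∉ = J.through-core F F≤ ¬iA oB
    in y , x , inj₂ cy , inj₂ cx , yu , xy , vx , y∉ , x∉
  ... | inj₂ ¬iA | inj₂ ¬oB = ⊥-elim ([ (λ e → true≢false e ¬iA) , (λ e → true≢false e ¬oB) ]′ c)

  connect : ∀ {u v} F → length F ≤ k * 24 → Unique F → Compat u v →
            ∃ λ w → H.Path u w v × length w ≤ 2 × Unique (w ++ F) × All OK w
  connect {u} {v} F F≤ uF c =
    case detour (source u) v F F≤ c of λ { (x , y , okx , oky , ux , xy , yv , x∉ , y∉) →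
      x ∷ y ∷ [] ,
      lift-path (x ∷ y ∷ []) (ordinary-∉T (OK-ordinary okx) ∷ ordinary-∉T (OK-ordinary oky) ∷ []) (ux , xy , yv) ,
      ≤-refl ,
      ((λ { refl → true≢false xy (loopless D x) }) ∷ All.tabulate (λ { z∈ refl → x∉ z∈ })) ∷
        All.tabulate (λ { z∈ refl → y∉ z∈ }) ∷ uF ,
      okx ∷ oky ∷ [] }

  -- Crossing vertices are the passages from A to B. Those in neither class can be entered from B
  -- and left into A.
  crossing neither : V → Bool
  crossing v = (fromA v ∧ toB v) ∧ not (special v)
  neither v = (not (fromA v) ∧ not (toB v)) ∧ not (special v)

  crossing-few : length (sel crossing) ≤ k * 10
  crossing-few = ≤-trans (≤-reflexive (length-sel crossing)) (≤-trans (#-mono in-C) I.C-few)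
    where
    in-C : ∀ v → crossing v ≡ true → I.C v ≡ true
    in-C v e with ∧-split {fromA v} (proj₁ (∧-split e))
    ... | iA , oB = ∧-join (not-false (¬true⇒false (λ Av → true≢false oB (I.A⇒¬toB Av))))
                           (not-false (¬true⇒false (λ Bv → true≢false iA (I.B⇒¬fromA Bv))))

  -- Some core vertex of A sends all its arcs into fromA, so fromA has more than δ elements;
  -- likewise for toB, and two such sets share at least k + 1 vertices.
  both-many : 1 + k ≤ # (λ v → fromA v ∧ toB v)
  both-many = both-sides k I.fromA-large J.fromA-large (≤-reflexive (#-∪∩ fromA toB)) (#≤n _) half

  Bridge : List V → List V → Set
  Bridge xs F = ∃₂ λ β α → ∃ λ ρ → J.core β ≡ true × I.core α ≡ true × β ∉ F × α ∉ F × ρ ↭ xs × G.Path β ρ α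

  -- The trail has to pass from B to A once anyway, and a Hamiltonian path of all vertices in
  -- neither class fits into this passage.
  bridge : ∀ xs F → Unique xs → (∀ {v} → v ∈ xs → fromA v ≡ false × toB v ≡ false) → length F ≤ k * 24 → Bridge xs F
  bridge [] F u h F≤ =
    let β , cβ , β∉ = J.any-core F F≤
        α , cα , α∉ = I.any-core F F≤
    in β , α , [] , cβ , cα , β∉ , α∉ , ↭-refl , B⟶A cβ cα
  bridge (x ∷ xs) F u h F≤ =
    let r , rs , ℓ , perm , run = G.ham-path x xs u (λ {y} {z} _ _ → semi y z)
        β , cβ , βr , β∉ = J.into-core F F≤ (proj₁ (h (∈-resp-↭ perm (here refl))))
        α , cα , ℓα , α∉ = I.into-core F F≤ (proj₂ (h (∈-resp-↭ perm (G.run-last run))))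
    in β , α , r ∷ rs , cβ , cα , β∉ , α∉ , perm , βr , G.run-path run ℓα

  Goal : Set
  Goal = ∃₂ λ L ℓ → H.Run s L ℓ × ℓ ∈ T × s ∷ L ↭ allFin n

  module Classes (F : List V) (uF : Unique F) (okF : All OK F) (F≤ : length F ≤ k * 24) where
    module IA = I.Absorb F F≤
    module JA = J.Absorb F F≤
    Z R LA LB : List V
    Z = sel crossing
    R = sel neither
    LA = sel IA.rest
    LB = sel JA.rest

    glue : ∀ {xs ys} (p : V → Bool) → Unique xs → (∀ {v} → v ∈ xs → p v ≡ true) →
           Unique ys × (∀ {v} → v ∈ ys → p v ≡ false) → Unique (xs ++ ys)
    glue p ux px (uy , py) = Unique.++⁺ ux uy (λ (x∈ , y∈) → true≢false (px x∈) (py y∈))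

    ++-elim : ∀ {xs ys : List V} {P : V → Set} → (∀ {v} → v ∈ xs → P v) → (∀ {v} → v ∈ ys → P v) →
              ∀ {v} → v ∈ xs ++ ys → P v
    ++-elim {xs} f g v∈ = [ f , g ]′ (∈-++⁻ xs v∈)

    OK-type : ∀ {v} → OK v → fromA v ∨ toB v ≡ true
    OK-type {v} = [ (λ c → ∨-inl (I.core-fromA c)) , (λ c → ∨-inr {fromA v} (J.core-fromA c)) ]′

    OK-single : ∀ {v} → OK v → fromA v ∧ toB v ≡ false
    OK-single {v} (inj₁ c) = ¬true⇒false (λ e → true≢false (proj₂ (∧-split {fromA v} e)) (I.A⇒¬toB (I.core-A c)))
    OK-single {v} (inj₂ c) = ¬true⇒false (λ e → true≢false (proj₁ (∧-split e)) (I.B⇒¬fromA (J.core-A c)))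

    R-types : ∀ {v} → v ∈ R → fromA v ≡ false × toB v ≡ false × special v ≡ false
    R-types {v} v∈ with ∧-split {not (fromA v) ∧ not (toB v)} (∈-sel⁻ {neither} v∈)
    ... | e , o with ∧-split {not (fromA v)} e
    ...   | a , b = not-true a , not-true b , not-true o

    LA-types : ∀ {v} → v ∈ LA → fromA v ≡ true × toB v ≡ false × special v ≡ false × mem F v ≡ false
    LA-types {v} v∈ with ∧-split {not (mem F v)} (∈-sel⁻ {IA.rest} v∈)
    ... | f , e with ∧-split {fromA v ∧ not (toB v)} e
    ...   | e′ , o with ∧-split {fromA v} e′
    ...     | a , b = a , not-true b , not-true o , not-true f

    LB-types : ∀ {v} → v ∈ LB → toB v ≡ true × fromA v ≡ false × special v ≡ false × mem F v ≡ false
    LB-types {v} v∈ with ∧-split {not (mem F v)} (∈-sel⁻ {JA.rest} v∈)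
    ... | f , e with ∧-split {toB v ∧ not (fromA v)} e
    ...   | e′ , o with ∧-split {toB v} e′
    ...     | a , b = a , not-true b , not-true o , not-true f

    Z-types : ∀ {v} → v ∈ Z → fromA v ∧ toB v ≡ true × special v ≡ false
    Z-types {v} v∈ with ∧-split {fromA v ∧ toB v} (∈-sel⁻ {crossing} v∈)
    ... | e , o = e , not-true o

    -- Each `glue` names a Boolean true on one class and false on all later ones, so five tests
    -- replace fifteen comparisons of pairs.
    all-vertices : (s ∷ T) ++ Z ++ F ++ R ++ LA ++ LB ↭ allFin n
    all-vertices = enumeration unique covered
      where
      ∧-falseˡ : ∀ {a b} → a ≡ false → a ∧ b ≡ false
      ∧-falseˡ refl = refl
      ∧-falseʳ : ∀ {a b} → b ≡ false → a ∧ b ≡ false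
      ∧-falseʳ {false} _ = refl
      ∧-falseʳ {true} e = e
      neither-type : ∀ {v} → fromA v ≡ false → toB v ≡ false → fromA v ∨ toB v ≡ false
      neither-type {v} e e′ = trans (cong (_∨ toB v) e) e′
      unique : Unique ((s ∷ T) ++ Z ++ F ++ R ++ LA ++ LB)
      unique = glue special uniq-sT mem⁺
        ( glue (λ v → fromA v ∧ toB v) (sel-unique crossing) (proj₁ ∘ Z-types)
          ( glue (mem F) uF mem⁺
            ( glue (λ v → not (fromA v ∨ toB v)) (sel-unique neither)
                (λ v∈ → let a , b , _ = R-types v∈ in not-false (neither-type a b))
              ( glue fromA (sel-unique IA.rest) (proj₁ ∘ LA-types)
                ( sel-unique JA.rest , (λ v∈ → let _ , b , _ = LB-types v∈ in b))
              , ++-elim {LA} (λ v∈ → let a , _ = LA-types v∈ in cong not (∨-inl a))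
                        (λ {v} v∈ → let b , _ = LB-types v∈ in cong not (∨-inr {fromA v} b)))
            , ++-elim {R} (λ v∈ → let a , b , _ = R-types v∈ in
                  ¬true⇒false (λ v∈F → true≢false (OK-type (All.lookup okF (mem⁻ {F} v∈F))) (neither-type a b)))
                (++-elim {LA} (λ v∈ → let _ , _ , _ , f = LA-types v∈ in f)
                              (λ v∈ → let _ , _ , _ , f = LB-types v∈ in f)))
          , ++-elim {F} (OK-single ∘ All.lookup okF)
              (++-elim {R} (∧-falseˡ ∘ proj₁ ∘ R-types)
                (++-elim {LA} (λ {v} v∈ → let _ , b , _ = LA-types v∈ in ∧-falseʳ {fromA v} b)
                              (λ v∈ → let _ , a , _ = LB-types v∈ in ∧-falseˡ a))))
        , ++-elim {Z} (proj₂ ∘ Z-types)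
            (++-elim {F} (OK-ordinary ∘ All.lookup okF)
              (++-elim {R} (λ v∈ → let _ , _ , o = R-types v∈ in o)
                (++-elim {LA} (λ v∈ → let _ , _ , o , _ = LA-types v∈ in o)
                              (λ v∈ → let _ , _ , o , _ = LB-types v∈ in o)))))
      covered : ∀ v → v ∈ (s ∷ T) ++ Z ++ F ++ R ++ LA ++ LB
      covered v with bool (special v)
      ... | inj₁ e = ∈-++⁺ˡ (mem⁻ {s ∷ T} e)
      ... | inj₂ o with bool (mem F v)
      ...   | inj₁ e = ∈-++⁺ʳ (s ∷ T) (∈-++⁺ʳ Z (∈-++⁺ˡ (mem⁻ {F} e)))
      ...   | inj₂ f with bool (fromA v) | bool (toB v)
      ...     | inj₁ a | inj₁ b = ∈-++⁺ʳ (s ∷ T) (∈-++⁺ˡ (∈-sel⁺ (∧-join (∧-join a b) (not-false o))))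
      ...     | inj₂ a | inj₂ b = ∈-++⁺ʳ (s ∷ T) (∈-++⁺ʳ Z (∈-++⁺ʳ F (∈-++⁺ˡ
                  (∈-sel⁺ (∧-join (∧-join (not-false a) (not-false b)) (not-false o))))))
      ...     | inj₁ a | inj₂ b = ∈-++⁺ʳ (s ∷ T) (∈-++⁺ʳ Z (∈-++⁺ʳ F (∈-++⁺ʳ R (∈-++⁺ˡ
                  (∈-sel⁺ (∧-join (not-false f) (∧-join (∧-join a (not-false b)) (not-false o))))))))
      ...     | inj₂ a | inj₁ b = ∈-++⁺ʳ (s ∷ T) (∈-++⁺ʳ Z (∈-++⁺ʳ F (∈-++⁺ʳ R (∈-++⁺ʳ LA
                  (∈-sel⁺ (∧-join (not-false f) (∧-join (∧-join b (not-false a)) (not-false o))))))))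

  -- The trail follows P to u, sweeps the B side up to β, crosses the bridge to α, sweeps the A side
  -- up to v and continues along S. `toB` at the source of u and `fromA` at v are what the two
  -- sweeps need.
  finish : ∀ {P u F₀ v S ℓ} → H.Run s P u → toB (source u) ≡ true → Unique F₀ → All OK F₀ → length F₀ ≤ 2 →
           fromA v ≡ true → Chain Compat v S ℓ → 1 + length S ≤ k * 11 → ℓ ∈ T →
           P ++ v ∷ S ↭ F₀ ++ sel crossing ++ T → Goal
  finish {P} {u} {F₀} {v} {S} {ℓ} runP oB uF₀ okF₀ F₀≤ iA chain S≤ ℓ∈ permP =
    -- 24k has room for two vertices per entry of S, fewer than 22k in all, and for `F₀`, α and β.
    case H.realize {OK = OK} {M = k * 24} connect F₀ uF₀ (tail-room k F₀≤ S≤) chain of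
      λ { (W , S′ , runS , permS , W≤ , uWF , okW) →
        tie W S′ runS permS uWF (All.++⁺ okW okF₀)
          (≤-trans (≤-reflexive (cong (2 +_) (length-++ W))) (grown k W≤ F₀≤ S≤ 2≤k)) }
    where
    tie : ∀ W S′ → H.Run v S′ ℓ → S′ ↭ S ++ W → Unique (W ++ F₀) → All OK (W ++ F₀) →
          2 + length (W ++ F₀) ≤ k * 24 → Goal
    tie W S′ runS permS uWF okWF F≤ =
      case bridge (sel neither) (W ++ F₀) (sel-unique neither) types (≤-trans (m≤n+m _ 2) F≤) of
        λ { (β , α , ρ , cβ , cα , β∉ , α∉ , permρ , path) → close β α ρ cβ cα β∉ α∉ permρ path }
      where
      types : ∀ {x} → x ∈ sel neither → fromA x ≡ false × toB x ≡ false
      types {x} x∈ = let a , b = ∧-split {not (fromA x)} (proj₁ (∧-split (∈-sel⁻ {neither} x∈)))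
                     in not-true a , not-true b
      close : ∀ β α ρ → J.core β ≡ true → I.core α ≡ true → β ∉ W ++ F₀ → α ∉ W ++ F₀ → ρ ↭ sel neither →
              G.Path β ρ α → Goal
      close β α ρ cβ cα β∉ α∉ permρ path =
        case IA.absorb cα iA of λ { (WA , permA , pathA) →
        case JA.absorb cβ oB of λ { (WB , permB , pathB) →
          -- On the B side the absorption takes place in the reversed digraph and leads from β to
          -- the source of u.
          P ++ reverse WB ++ β ∷ ρ ++ α ∷ WA ++ v ∷ S′ , ℓ ,
          H.run-++ runP
            (H.path-run (reverse WB)
              (lift-path (reverse WB) (All.tabulate (λ x∈ → LB∉T (∈-resp-↭ (↭-trans (↭-reverse WB) permB) x∈)))
                (reverse-path (arc D) WB pathB))
            (H.path-run ρ
              (lift-path ρ (All.tabulate (λ x∈ → R∉T (∈-resp-↭ permρ x∈)))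
                (subst (λ y → G.Path y ρ α) (sym (source-∉ (ordinary-∉T (J.core-ordinary cβ)))) path))
            (H.path-run WA
              (lift-path WA (All.tabulate (λ x∈ → LA∉T (∈-resp-↭ permA x∈)))
                (subst (λ y → G.Path y WA v) (sym (source-∉ (ordinary-∉T (I.core-ordinary cα)))) pathA))
              runS))) ,
          ℓ∈ , arrange permA (↭-trans (↭-reverse WB) permB) } }
        where
        -- α and β count as used, so that neither sweep visits them.
        F : List V
        F = α ∷ β ∷ W ++ F₀
        uF : Unique F
        uF = ((λ { refl → disjoint α (I.core-A cα) (J.core-A cβ) }) ∷ All.tabulate (λ { x∈ refl → α∉ x∈ })) ∷
             All.tabulate (λ { x∈ refl → β∉ x∈ }) ∷ uWF
        open Classes F uF (inj₁ cα ∷ inj₂ cβ ∷ okWF) F≤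
        R∉T : ∀ {x} → x ∈ R → x ∉ T
        R∉T x∈ = let _ , _ , o = R-types x∈ in ordinary-∉T o
        LA∉T : ∀ {x} → x ∈ LA → x ∉ T
        LA∉T x∈ = let _ , _ , o , _ = LA-types x∈ in ordinary-∉T o
        LB∉T : ∀ {x} → x ∈ LB → x ∉ T
        LB∉T x∈ = let _ , _ , o , _ = LB-types x∈ in ordinary-∉T o
        arrange : ∀ {WA WB′} → WA ↭ LA → WB′ ↭ LB →
                  s ∷ P ++ WB′ ++ β ∷ ρ ++ α ∷ WA ++ v ∷ S′ ↭ allFin n
        arrange permA permB =
          ↭-trans (prep s (++⁺ˡ P (++⁺ permB (prep β (++⁺ permρ (prep α (++⁺ permA (prep v permS))))))))
          (↭-trans (prep s (↭-trans (regroup₃ P LB (β ∷ []) R (α ∷ []) LA (v ∷ S) W)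
            (↭-trans (++⁺ʳ _ permP) (regroup₄ F₀ Z T LB (β ∷ []) R (α ∷ []) LA W))))
            all-vertices)

  last-in : ∀ {Q : V → V → Set} {u ℓ y ys} xs → Chain Q u (xs ++ y ∷ ys) ℓ → ℓ ∈ y ∷ ys
  last-in [] (_ ∷ c) = chain-last c
  last-in (x ∷ xs) (_ ∷ c) = last-in xs c

  chain-into : ∀ v xs → All (λ x → fromA x ≡ true) xs → ∃ λ ℓ → Chain Compat v xs ℓ
  chain-into v [] [] = v , stop
  chain-into v (x ∷ xs) (e ∷ a) = let ℓ , c = chain-into x xs a in ℓ , inj₁ e ∷ c

  chain-out : ∀ v xs → All (λ x → toB (source x) ≡ true) (v ∷ xs) → ∃ λ ℓ → Chain Compat v xs ℓ
  chain-out v [] _ = v , stop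
  chain-out v (x ∷ xs) (e ∷ a) = let ℓ , c = chain-out x xs a in ℓ , inj₂ e ∷ c

  chain-snoc : ∀ v xs t → All (λ x → toB (source x) ≡ true) (v ∷ xs) → Chain Compat v (xs ++ t ∷ []) t
  chain-snoc v [] t (e ∷ _) = inj₂ e ∷ stop
  chain-snoc v (x ∷ xs) t (e ∷ a) = inj₂ e ∷ chain-snoc x xs t a

  Arranged : List V → List V → Set
  Arranged xs ts = ∃₂ λ v S → ∃ λ ℓ → fromA v ≡ true × Chain Compat v S ℓ × ℓ ∈ ts × v ∷ S ↭ xs ++ ts

  Crossing : V → Set
  Crossing z = fromA z ≡ true × toB (source z) ≡ true

  -- If s has few arcs into B, then restarting at s leaves us on the A side, and a target with few
  -- arcs from A has to be entered right after a crossing vertex.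
  weave : ∀ zs tB tA → All Crossing zs → All (λ t → fromA t ≡ true) tA → length tB ≤ length zs →
          0 < length (tB ++ tA) → Arranged zs (tB ++ tA)
  weave [] [] (t ∷ tA) _ (iA ∷ a) _ _ =
    let ℓ , c = chain-into t tA a in t , tA , ℓ , iA , c , chain-last c , ↭-refl
  weave (z ∷ zs) [] (t ∷ tA) ((iA , _) ∷ cs) a _ _ =
    let ℓ , c = chain-into z (zs ++ t ∷ tA) (All.++⁺ (All.map proj₁ cs) a)
    in z , zs ++ t ∷ tA , ℓ , iA , c , last-in zs c , ↭-refl
  -- The trail must end in T, so all remaining crossing vertices precede the last target.
  weave (z ∷ zs) (t ∷ []) [] cs@((iA , _) ∷ _) a _ _ =
    z , zs ++ t ∷ [] , t , iA , chain-snoc z zs t (All.map proj₂ cs) , here refl , ↭-refl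
  weave (z ∷ zs) (t ∷ []) (t′ ∷ tA) ((iA , oB) ∷ cs) a (s≤s le) _ =
    case weave zs [] (t′ ∷ tA) cs a le (s≤s z≤n) of λ { (v , S , ℓ , iA′ , c , ℓ∈ , perm) →
      z , t ∷ v ∷ S , ℓ , iA , inj₂ oB ∷ inj₁ iA′ ∷ c , there ℓ∈ ,
      prep z (↭-trans (prep t perm) (↭-sym (shift t zs (t′ ∷ tA)))) }
  weave (z ∷ zs) (t ∷ t″ ∷ tB) tA ((iA , oB) ∷ cs) a (s≤s le) _ =
    case weave zs (t″ ∷ tB) tA cs a le (s≤s z≤n) of λ { (v , S , ℓ , iA′ , c , ℓ∈ , perm) →
      z , t ∷ v ∷ S , ℓ , iA , inj₂ oB ∷ inj₁ iA′ ∷ c , there ℓ∈ ,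
      prep z (↭-trans (prep t perm) (↭-sym (shift t zs (t″ ∷ tB ++ tA)))) }
  weave [] (_ ∷ _) tA _ _ () _

  -- Every entry can be left into B, targets by restarting at s, so any order is compatible. Only
  -- the first vertex has to lie in `fromA`.
  easy : ∀ zs tA tB → All Crossing zs → All (λ t → fromA t ≡ true) tA → (∀ {t} → t ∈ tA ++ tB → toB (source t) ≡ true) →
         0 < length zs + length tA → 0 < length (tA ++ tB) → Arranged zs (tA ++ tB)
  easy [] (t ∷ tA) tB _ (iA ∷ a) h _ _ =
    let ℓ , c = chain-out t (tA ++ tB) (All.tabulate h)
    in t , tA ++ tB , ℓ , iA , c , chain-last c , ↭-refl
  easy (z ∷ zs) tA tB cs@((iA , _) ∷ _) a h _ ne with tA ++ tB
  easy (z ∷ zs) tA tB cs@((iA , _) ∷ _) a h _ ne | t ∷ ts =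
    let ℓ , c = chain-out z (zs ++ t ∷ ts) (All.++⁺ (All.map proj₂ cs) (All.tabulate h))
    in z , zs ++ t ∷ ts , ℓ , iA , c , last-in zs c , ↭-refl

  tA tB : List V
  tA = select fromA T
  tB = select (not ∘ fromA) T

  tA-fromA : All (λ t → fromA t ≡ true) tA
  tA-fromA = All.tabulate (λ t∈ → proj₂ (∈-filter⁻ (λ x → fromA x ≟ᵇ true) {xs = T} t∈))

  T-perm : T ↭ tA ++ tB
  T-perm = select-split fromA T

  #tA+#tB : length tA + length tB ≡ k
  #tA+#tB = trans (sym (length-++ tA)) (trans (sym (↭-length T-perm)) #T)

  crossings : All Crossing (sel crossing)
  crossings = All.tabulate λ {z} z∈ →
    let e , o = ∧-split {fromA z ∧ toB z} (∈-sel⁻ {crossing} z∈)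
        a , b = ∧-split {fromA z} e
    in a , subst (λ y → toB y ≡ true) (sym (source-∉ (ordinary-∉T (not-true o)))) b

  sort-both : ∀ v → fromA v ∧ toB v ≡ true → v ≡ s ⊎ v ∈ sel crossing ++ tA
  sort-both v e with bool (special v)
  ... | inj₂ o = inj₂ (∈-++⁺ˡ (∈-sel⁺ (∧-join e (not-false o))))
  ... | inj₁ o with mem⁻ {s ∷ T} o
  ...   | here v≡s = inj₁ v≡s
  ...   | there v∈ = inj₂ (∈-++⁺ʳ (sel crossing) (∈-filter⁺ (λ x → fromA x ≟ᵇ true) v∈ (proj₁ (∧-split e))))

  hamiltonian-trail : Goal
  hamiltonian-trail with bool (toB s)
  ... | inj₁ oB = case arranged of λ { (v , S , ℓ , iA , c , ℓ∈ , perm) →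
      finish stop (trans (cong toB source-s) oB) [] [] z≤n iA c (S-short perm) (∈-resp-↭ (↭-sym T-perm) ℓ∈)
        (↭-trans perm (++⁺ˡ (sel crossing) (↭-sym T-perm))) }
    where
    -- s itself may be one of the k + 1 vertices.
    enough : 1 + k ≤ 1 + (length (sel crossing) + length tA)
    enough = ≤-trans both-many (≤-trans (#-⊆list (s ∷ sel crossing ++ tA)
      (λ v e → [ (λ v≡s → here v≡s) , there ]′ (sort-both v e))) (≤-reflexive (cong suc (length-++ (sel crossing)))))
    arranged : Arranged (sel crossing) (tA ++ tB)
    arranged = easy (sel crossing) tA tB crossings tA-fromA
      (λ t∈ → subst (λ y → toB y ≡ true) (sym (source-∈ (∈-resp-↭ (↭-sym T-perm) t∈))) oB)
      (≤-trans (≤-trans (s≤s z≤n) 2≤k) (≤-pred enough))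
      (≤-trans (≤-trans (s≤s z≤n) 2≤k) (≤-reflexive (trans (sym #tA+#tB) (sym (length-++ tA)))))
    S-short : ∀ {v : V} {S} → v ∷ S ↭ sel crossing ++ tA ++ tB → 1 + length S ≤ k * 11
    S-short perm = first-tail k (≤-reflexive (trans (↭-length perm) (trans (length-++ (sel crossing))
      (cong (length (sel crossing) +_) (trans (length-++ tA) #tA+#tB))))) crossing-few
  ... | inj₂ ¬oB = go (sel crossing) refl
    where
    T-perm′ : T ↭ tB ++ tA
    T-perm′ = ↭-trans T-perm (++-comm tA tB)
    enough : 1 + k ≤ length (sel crossing) + length tA
    enough = ≤-trans both-many (≤-trans (#-⊆list (sel crossing ++ tA)
      (λ v e → [ (λ { refl → true≢false (proj₂ (∧-split {fromA v} e)) ¬oB }) , id ]′ (sort-both v e)))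
      (≤-reflexive (length-++ (sel crossing))))
    -- s is not among the k + 1 vertices, and those in T belong to `tA`; so there is a crossing
    -- vertex for each member of `tB` and one to spare.
    more : 1 + length tB ≤ length (sel crossing)
    more = surplus k {length (sel crossing)} {length tA} {length tB} enough
      (≤-reflexive (sym #tA+#tB)) (≤-reflexive #tA+#tB)
    go : ∀ zs → sel crossing ≡ zs → Goal
    go [] eq = ⊥-elim (n≮0 (subst (λ xs → 1 + length tB ≤ length xs) eq more))
    go (z ∷ zs) eq with subst (All Crossing) eq crossings
    ... | (iAz , oBz) ∷ cs =
      -- The spare crossing vertex z takes the trail from s to the B side; x and y count as used
      -- from then on.
      case I.through-core {u = s} {v = z} [] z≤n ¬oB iAz of
        λ { (x , y , cx , cy , sx , xy , yz , _ , _) →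
      case weave zs tB tA cs tA-fromA (≤-pred (subst (λ xs → 1 + length tB ≤ length xs) eq more)) nonempty of
        λ { (v , S , ℓ , iA , c , ℓ∈ , perm) →
          finish {P = x ∷ y ∷ z ∷ []} {F₀ = x ∷ y ∷ []}
            (H.path-run (x ∷ y ∷ []) (lift-path (x ∷ y ∷ [])
              (ordinary-∉T (I.core-ordinary cx) ∷ ordinary-∉T (I.core-ordinary cy) ∷ [])
              (subst (λ q → arc D q x ≡ true) (sym source-s) sx , xy , yz)) stop)
            oBz (((λ { refl → true≢false xy (loopless D x) }) ∷ []) ∷ [] ∷ []) (inj₁ cx ∷ inj₁ cy ∷ []) ≤-refl
            iA c (S-short perm) (∈-resp-↭ (↭-sym T-perm′) ℓ∈)
            (prep x (prep y (↭-trans (prep z (↭-trans perm (++⁺ˡ zs (↭-sym T-perm′))))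
              (↭-reflexive (cong (_++ T) (sym eq)))))) } }
      where
      nonempty : 0 < length (tB ++ tA)
      nonempty = ≤-trans (≤-trans (s≤s z≤n) 2≤k) (≤-reflexive (trans (sym #T) (↭-length T-perm′)))
      S-short : ∀ {v : V} {S} → v ∷ S ↭ zs ++ tB ++ tA → 1 + length S ≤ k * 11
      S-short perm = first-prefix k
        (≤-reflexive (trans (↭-length perm) (trans (length-++ zs)
          (cong (length zs +_) (trans (sym (↭-length T-perm′)) #T)))))
        (subst (λ xs → length xs ≤ k * 10) eq crossing-few)

-- The degree and order conditions in the form used above

size-tabulate : ∀ {n} (f : Fin n → Bool) → Subset.∣ Vec.tabulate f ∣ ≡ Counting.#_ f
size-tabulate {n} f = trans (go n f) (Σ-tabulate n f)
  where
  go : ∀ m (g : Fin m → Bool) → Subset.∣ Vec.tabulate g ∣ ≡ Σ[ 𝟙 ] (tabulate g)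
  go zero g = refl
  go (suc m) g with g zero
  ... | true = cong suc (go m (g ∘ suc))
  ... | false = go m (g ∘ suc)
  Σ-tabulate : ∀ m (g : Fin m → Bool) → Σ[ 𝟙 ] (tabulate g) ≡ count g (allFin m)
  Σ-tabulate m g = shifted m id
    where
    shifted : ∀ l (h : Fin l → Fin m) → Σ[ 𝟙 ] (tabulate (g ∘ h)) ≡ count g (tabulate h)
    shifted zero h = refl
    shifted (suc l) h = cong (𝟙 (g (h zero)) +_) (shifted l (h ∘ suc))

half-bound : ∀ m → m ≤ ⌈ m /2⌉ + ⌈ m /2⌉
half-bound m = halves m ((m + 1) / 2) ((m + 1) % 2) (m≡m%n+[m/n]*n (m + 1) 2) (m%n<n (m + 1) 2)
  where
  halves : ∀ m q r → m + 1 ≡ r + q * 2 → r < 2 → m ≤ q + q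
  halves m q r e r<2 = +-cancelʳ-≤ 1 m (q + q) (≤-trans (≤-reflexive e)
    (≤-trans (+-monoˡ-≤ (q * 2) (≤-pred r<2)) (≤-reflexive (regroup q))))
    where
    regroup : ∀ q → 1 + q * 2 ≡ q + q + 1
    regroup = solve-∀

module _ (k n : ℕ) (2≤k : 2 ≤ k) (large : (9 * k) ^ 5 ≤ n) where

  k²-bound : k * k * 4232 ≤ n
  -- 4232 + 54817 = 59049 = 9⁵.
  k²-bound = ≤-trans (≤-trans (*-monoʳ-≤ (k * k) (m≤m+n 4232 54817))
    (≤-trans (m≤m*n (k * k * 59049) (k * k * k) {{k³≢0}}) (≤-reflexive (fifth-power k)))) large
    where
    instance
      k≢0 : NonZero k
      k≢0 = >-nonZero (≤-trans (s≤s z≤n) 2≤k)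
    k³≢0 : NonZero (k * k * k)
    k³≢0 = m*n≢0 (k * k) k {{m*n≢0 k k}}
    fifth-power : ∀ k → k * k * 59049 * (k * k * k) ≡ 9 * k * (9 * k * (9 * k * (9 * k * (9 * k * 1))))
    fifth-power = solve-∀

  k-bound : k * 1000 ≤ n
  k-bound = ≤-trans (*-mono-≤ (m≤m*n k k {{>-nonZero (≤-trans (s≤s z≤n) 2≤k)}}) (m≤m+n 1000 3232)) k²-bound

theorem1 : (k n : ℕ) → 2 ≤ k → (9 * k) ^ 5 ≤ n →
    (D : Digraph n) → Semicomplete D →
    MinSemiDegreeAtLeast D ⌈ n + k ∸ 1 /2⌉ →
    (s : Fin n) (t : Fin k → Fin n) → Injective _≡_ _≡_ t → (∀ i → t i ≢ s) →
    Σ (Fin k → List (Fin n)) λ P →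
    (∀ i → IsPath D s (t i) (P i)) ×
    (∀ i j → i ≢ j → ∀ v → v ∈ P i → v ∈ P j → v ≡ s) ×
    (∀ v → ∃ λ i → v ∈ P i)
theorem1 k@(suc k₀) n 2≤k large D semi deg s t t-inj t≢s =
  case cut-dichotomy (arc D) (k * 10) of λ
    { (inj₁ no-cut) → conclude (HighlyConnected.hamiltonian-trail D semi s (t zero) (tabulate (t ∘ suc)) k
        (length-tabulate t) unique 2≤k (k-bound k n 2≤k large) δ half out inn no-cut)
    ; (inj₂ cut) → conclude (Separable.hamiltonian-trail D semi s (tabulate t) k
        (length-tabulate t) unique 2≤k (k-bound k n 2≤k large) (k²-bound k n 2≤k large) δ half out inn cut) }
  where
  open Counting {n}
  δ : ℕ
  δ = ⌈ n + k ∸ 1 /2⌉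
  -- Clears the ceiling and the truncated subtraction, so that all later counting is linear in δ.
  half : n + k ≤ 1 + (δ + δ)
  half = ≤-trans (m≤n+m∸n (n + k) 1) (+-monoʳ-≤ 1 (half-bound (n + k ∸ 1)))
  out : ∀ u → δ ≤ # (λ v → arc D u v)
  out u = ≤-trans (proj₁ (deg u)) (≤-reflexive (size-tabulate (λ v → arc D u v)))
  inn : ∀ v → δ ≤ # (λ u → arc D u v)
  inn v = ≤-trans (proj₂ (deg v)) (≤-reflexive (size-tabulate (λ u → arc D u v)))
  unique : Unique (s ∷ tabulate t)
  unique = All.tabulate (λ { v∈ refl → let i , e = ∈-tabulate⁻ {f = t} v∈ in t≢s i (sym e) }) ∷ Unique.tabulate⁺ t-inj
  conclude : (∃₂ λ L ℓ → Trail.H.Run D s (tabulate t) s L ℓ × ℓ ∈ tabulate t × s ∷ L ↭ allFin n) → Cover D k s t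
  conclude (L , ℓ , run , ℓ∈ , perm) = cover D s t t-inj t≢s run ℓ∈ perm
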